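{- Let $p$ be an odd prime and let $\mathcal{R}_p=\{x^2: x\in\mathbb{F}_p^\times\}$ be the set of (nonzero) quadratic residues in $\mathbb{F}_p$. Assume that $\mathcal{A},\mathcal{B}\subseteq\mathbb{F}_p$ satisfy $|\mathcal{A}|,|\mathcal{B}|\geqslant 2$ and $\mathcal{A}+\mathcal{B}=\mathcal{R}_p$, where $\mathcal{A}+\mathcal{B}=\{a+b:a\in\mathcal{A},b\in\mathcal{B}\}$. Then \[\frac{1}{4}\sqrt{p}+\frac18\leqslant |\mathcal{A}|,|\mathcal{B}|< 2\sqrt{p}-1.\]
   Context: $\mathbb{F}_p$ is the finite field with $p$ elements; $\mathcal{R}_p$ has $(p-1)/2$ elements. -}

module Defs where

open import Data.Nat using (ℕ; zero; suc; _+_; _*_; NonZero)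
open import Data.Nat.DivMod using (_mod_)
open import Data.Fin using (Fin; toℕ)
open import Data.Fin.Subset using (Subset; _∈_)
open import Data.Product using (Σ; ∃; _×_; _,_)
open import Relation.Binary.PropositionalEquality using (_≡_; _≢_)
open import Function.Bundles using (_⇔_)

-- 𝔽_p is modelled as Fin p with arithmetic modulo p.
_+ₚ_ : {p : ℕ} .{{_ : NonZero p}} → Fin p → Fin p → Fin p
_+ₚ_ {p} a b = (toℕ a + toℕ b) mod p

_*ₚ_ : {p : ℕ} .{{_ : NonZero p}} → Fin p → Fin p → Fin p
_*ₚ_ {p} a b = (toℕ a * toℕ b) mod p

IsQR : {p : ℕ} .{{_ : NonZero p}} → Fin p → Set
IsQR {p} z = ∃ λ (x : Fin p) → (toℕ x ≢ 0) × (x *ₚ x ≡ z)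

InSumset : {p : ℕ} .{{_ : NonZero p}} → Subset p → Subset p → Fin p → Set
InSumset A B z = ∃ λ a → ∃ λ b → (a ∈ A) × (b ∈ B) × (a +ₚ b ≡ z)

SumsetIsQR : {p : ℕ} .{{_ : NonZero p}} → Subset p → Subset p → Set
SumsetIsQR {p} A B = (z : Fin p) → InSumset A B z ⇔ IsQR z

{-# OPTIONS --safe #-}
-- Put q = (p - 1)/2, C = -B, m = |A| and n = |C|, so that x is a nonzero square iff x^q = 1.  Following Hanson
-- and Petridis, let F + 1 be the divided difference of y ↦ y^(q+m-1) at the m points X + a, a ∈ A.  Then F has
-- degree q and vanishes to order m at every -c, c ∈ C, because there the points are squares and y^(q+k) may be
-- replaced by yᵏ.  Hence m n ≤ q; as every square is a sum, m n = q and F = const · gᵐ with g = ∏ (X + c).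
--
-- Let φ = ∏ (X + a).  Comparing the Taylor coefficients of F and const · gᵐ of order m + 1 at the roots of g gives
-- m (m + 1) φ g″ + 3 φ′ g′ = K g for a polynomial K of degree at most m - 2, and those of order m + 2 then show that
-- a polynomial 3 (m - 1) (m - 2) (4 m + 3) φ′² + φ · (⋯) of degree at most 2m - 2 vanishes at the n roots of g.
-- For m ≥ 3 it is not zero, since φ′ does not vanish at the roots of φ.  So n ≤ 2m - 2, and likewise m ≤ 2n - 2,
-- which is stronger than required.
--
-- For m = 2, the bound m n ≤ q makes C maximal.  If A = {a, a′} and d = a′ - a, it follows that the maximal runs of
-- consecutive k with k d a square have length exactly 2, which small values and the least nonresidue contradict.
module Submission where

open import Defs
open import Data.Nat.Primality using (Prime; euclidsLemma; prime⇒nonTrivial)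
open import Data.Fin.Subset using (Subset; ∣_∣)
open import Data.Product using (_×_; _,_; ∃; proj₁; proj₂)
open import Relation.Binary.PropositionalEquality
  using (_≡_; _≢_; refl; sym; trans; cong; cong₂; subst; subst₂; module ≡-Reasoning)
open import Data.Nat.DivMod using (_%_; _/_; _mod_; m≡m%n+[m/n]*n)
import Data.Nat as ℕ
import Data.Nat.Properties as ℕ
import Data.Nat.Divisibility as ℕ
import Data.Nat.Tactic.RingSolver as ℕ-Solver

-- The comparison of Taylor coefficients is informative for the following reason. At b = -c the
-- divided differences `dd S k` of yᵏ satisfy a linear recurrence whose coefficients are, up to
-- sign, the Taylor coefficients of φ at b. The sequence has period q and starts with |A| - 1 zeros,
-- so near k = q the recurrence is short: its terms at q - 1, q - 2, q - 3 are tied together by φ,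
-- φ′ and φ″ at b alone. Up to binomials these terms are the coefficients of F of orders |A|, |A| +
-- 1, |A| + 2, which F = const · g^|A| expresses through g′, g″ and g‴. The relation of order |A| +
-- 1 by itself only makes a polynomial involving both sets divisible by g, which bounds nothing. The
-- next order is what allows the derivatives of g to be eliminated, leaving a polynomial whose
-- degree depends on |A| only. The factor |A| - 2 in `β` is why pairs need the separate argument on
-- runs. From `Auxiliary` to `Local`, `m` is |A| - 1 and `M` is |A|.

module SumsetsOfSquares where

  open import Data.Nat using (ℕ; zero; suc; z≤n; s≤s; NonZero)
  open import Data.Nat.Combinatorics using (nCk+nC[k+1]≡[n+1]C[k+1]; nC1≡n) renaming (_C_ to choose)
  open import Data.Nat.Combinatorics.Specification using (k>n⇒nCk≡0)
  open import Data.Nat.Induction using (<-rec)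
  open import Data.Integer using (ℤ; +_; -[1+_]; _+_; _*_; _-_; -_; _^_)
  import Data.Integer as ℤ
  import Data.Integer.Properties as ℤ
  open import Data.Integer.DivMod using (_%ℕ_; _/ℕ_; a≡a%ℕn+[a/ℕn]*n; n%ℕd<d)
  open import Data.Integer.Divisibility.Signed using (_∣_; ∣ᵤ⇒∣; ∣⇒∣ᵤ; ∣m∣n⇒∣m+n; ∣n⇒∣m*n; _∣?_)
  open import Data.Integer.Tactic.RingSolver using (solve-∀)
  open import Data.Fin as Fin using (Fin; toℕ)
  import Data.Fin.Properties as Fin
  open import Data.Fin.Subset using () renaming (_∈_ to _∈ˢ_)
  open import Data.Vec using ([]; _∷_; here; there)
  open import Data.List using (List; []; _∷_; length; map; lookup; applyUpTo)
  import Data.List.Properties as List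
  open import Data.List.Membership.Propositional using (_∈_)
  open import Data.List.Membership.Propositional.Properties using (∈-map⁺; ∈-lookup)
  open import Data.List.Relation.Unary.All as All using (All; []; _∷_)
  import Data.List.Relation.Unary.All.Properties as All
  open import Data.List.Relation.Unary.AllPairs as AllPairs using (AllPairs; []; _∷_)
  import Data.List.Relation.Unary.AllPairs.Properties as AllPairs
  open import Data.List.Relation.Unary.Any as Any using (Any; here; there)
  import Data.List.Relation.Unary.Any.Properties as Any
  open import Data.Bool using (true; false)
  open import Data.Sum as Sum using (_⊎_; inj₁; inj₂; [_,_]′)
  open import Data.Empty using (⊥; ⊥-elim)
  open import Function using (_∘_; id)
  open import Function.Bundles using (Equivalence; mk⇔)
  open import Relation.Nullary using (¬_; Dec; yes; no; contradiction)
  open import Relation.Nullary.Decidable using (map′)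
  open import Relation.Binary.Definitions using (tri<; tri≈; tri>)


  -- Integers modulo p

  module Congruence (p : ℕ) where

    infix 4 _≈_ _≉_

    record _≈_ (x y : ℤ) : Set where
      constructor congruent
      field divides : + p ∣ x - y
    open _≈_ public

    _≉_ : ℤ → ℤ → Set
    x ≉ y = ¬ x ≈ y

    _≈?_ : ∀ x y → Dec (x ≈ y)
    x ≈? y = map′ congruent divides (+ p ∣? (x - y))

    -- A congruence x ≈ y follows from x₁ ≈ y₁, x₂ ≈ y₂, … once x - y is exhibited as an integral
    -- linear combination of the xᵢ - yᵢ.
    combine₁ : ∀ {x y x₁ y₁} c → x₁ ≈ y₁ → x - y ≡ c * (x₁ - y₁) → x ≈ y
    combine₁ c (congruent d) eq = congruent (subst (+ p ∣_) (sym eq) (∣n⇒∣m*n c d))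

    combine₂ : ∀ {x y x₁ y₁ x₂ y₂} c₁ c₂ → x₁ ≈ y₁ → x₂ ≈ y₂ →
               x - y ≡ c₁ * (x₁ - y₁) + c₂ * (x₂ - y₂) → x ≈ y
    combine₂ c₁ c₂ (congruent d₁) (congruent d₂) eq =
      congruent (subst (+ p ∣_) (sym eq) (∣m∣n⇒∣m+n (∣n⇒∣m*n c₁ d₁) (∣n⇒∣m*n c₂ d₂)))

    combine₃ : ∀ {x y x₁ y₁ x₂ y₂ x₃ y₃} c₁ c₂ c₃ → x₁ ≈ y₁ → x₂ ≈ y₂ → x₃ ≈ y₃ →
               x - y ≡ c₁ * (x₁ - y₁) + c₂ * (x₂ - y₂) + c₃ * (x₃ - y₃) → x ≈ y
    combine₃ c₁ c₂ c₃ (congruent d₁) (congruent d₂) (congruent d₃) eq =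
      congruent (subst (+ p ∣_) (sym eq)
        (∣m∣n⇒∣m+n (∣m∣n⇒∣m+n (∣n⇒∣m*n c₁ d₁) (∣n⇒∣m*n c₂ d₂)) (∣n⇒∣m*n c₃ d₃)))

    ≡⇒≈ : ∀ {x y} → x ≡ y → x ≈ y
    ≡⇒≈ {x} refl = congruent (subst (+ p ∣_) (sym (ℤ.+-inverseʳ x)) (∣ᵤ⇒∣ (p ℕ.∣0)))

    ≈-refl : ∀ {x} → x ≈ x
    ≈-refl = ≡⇒≈ refl

    ≈-sym : ∀ {x y} → x ≈ y → y ≈ x
    ≈-sym {x} {y} e = combine₁ (- + 1) e (identity x y)
      where
      identity : ∀ x y → y - x ≡ - + 1 * (x - y)
      identity = solve-∀

    ≈-trans : ∀ {x y z} → x ≈ y → y ≈ z → x ≈ z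
    ≈-trans {x} {y} {z} e f = combine₂ (+ 1) (+ 1) e f (identity x y z)
      where
      identity : ∀ x y z → x - z ≡ + 1 * (x - y) + + 1 * (y - z)
      identity = solve-∀

    +-cong : ∀ {x x′ y y′} → x ≈ x′ → y ≈ y′ → x + y ≈ x′ + y′
    +-cong {x} {x′} {y} {y′} e f = combine₂ (+ 1) (+ 1) e f (identity x x′ y y′)
      where
      identity : ∀ x x′ y y′ → x + y - (x′ + y′) ≡ + 1 * (x - x′) + + 1 * (y - y′)
      identity = solve-∀

    *-cong : ∀ {x x′ y y′} → x ≈ x′ → y ≈ y′ → x * y ≈ x′ * y′
    *-cong {x} {x′} {y} {y′} e f = combine₂ y x′ e f (identity x x′ y y′)
      where
      identity : ∀ x x′ y y′ → x * y - x′ * y′ ≡ y * (x - x′) + x′ * (y - y′)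
      identity = solve-∀

    +-zero : ∀ {x y} → x ≈ + 0 → y ≈ + 0 → x + y ≈ + 0
    +-zero = +-cong

    *-zeroˡ : ∀ {x} y → x ≈ + 0 → x * y ≈ + 0
    *-zeroˡ {x} y e = *-cong e (≈-refl {y})

    *-zeroʳ : ∀ x {y} → y ≈ + 0 → x * y ≈ + 0
    *-zeroʳ x {y} e = combine₁ x e (identity x y)
      where
      identity : ∀ x y → x * y - + 0 ≡ x * (y - + 0)
      identity = solve-∀

    ^-cong : ∀ {x y} n → x ≈ y → x ^ n ≈ y ^ n
    ^-cong zero    e = ≈-refl
    ^-cong (suc n) e = *-cong e (^-cong n e)

    ≈0⇒∣ : ∀ {x} → x ≈ + 0 → p ℕ.∣ ℤ.∣ x ∣
    ≈0⇒∣ {x} (congruent d) = ∣⇒∣ᵤ (subst (+ p ∣_) (ℤ.+-identityʳ x) d)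

    ∣⇒≈0 : ∀ {x} → p ℕ.∣ ℤ.∣ x ∣ → x ≈ + 0
    ∣⇒≈0 {x} d = congruent (subst (+ p ∣_) (sym (ℤ.+-identityʳ x)) (∣ᵤ⇒∣ d))

    ≈⇒-≈0 : ∀ {x y} → x ≈ y → x - y ≈ + 0
    ≈⇒-≈0 {x} {y} e = combine₁ (+ 1) e (identity x y)
      where
      identity : ∀ x y → x - y - + 0 ≡ + 1 * (x - y)
      identity = solve-∀

    -≈0⇒≈ : ∀ {x y} → x - y ≈ + 0 → x ≈ y
    -≈0⇒≈ {x} {y} e = combine₁ (+ 1) e (identity x y)
      where
      identity : ∀ x y → x - y ≡ + 1 * (x - y - + 0)
      identity = solve-∀

    module _ (prime : Prime p) where

      zero-product : ∀ {x y} → x * y ≈ + 0 → x ≈ + 0 ⊎ y ≈ + 0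
      zero-product {x} {y} e with euclidsLemma ℤ.∣ x ∣ ℤ.∣ y ∣ prime (subst (p ℕ.∣_) (ℤ.abs-* x y) (≈0⇒∣ e))
      ... | inj₁ d = inj₁ (∣⇒≈0 d)
      ... | inj₂ d = inj₂ (∣⇒≈0 d)

      cancel-zero : ∀ {x y} → x ≉ + 0 → x * y ≈ + 0 → y ≈ + 0
      cancel-zero x≉0 e = [ (λ x≈0 → contradiction x≈0 x≉0) , id ]′ (zero-product e)

      *-≉0 : ∀ {x y} → x ≉ + 0 → y ≉ + 0 → x * y ≉ + 0
      *-≉0 x≉0 y≉0 e = y≉0 (cancel-zero x≉0 e)

      cancel : ∀ {c x y} → c ≉ + 0 → c * x ≈ c * y → x ≈ y
      cancel {c} {x} {y} c≉0 e = -≈0⇒≈ (cancel-zero c≉0 (combine₁ (+ 1) e (identity c x y)))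
        where
        identity : ∀ c x y → c * (x - y) - + 0 ≡ + 1 * (c * x - c * y)
        identity = solve-∀

  -- Polynomials as families of Taylor expansions

  module Polynomials (p : ℕ) where

    open Congruence p public

    infix  4 _≋_
    infixl 7 _⊛_ _⊙_
    infixl 6 _⊕_

    Series : Set
    Series = ℕ → ℤ

    -- A polynomial is represented by its Taylor expansions: f b j is the coefficient of tʲ in f(b + t).
    Poly : Set
    Poly = ℤ → Series

    _≋_ : Series → Series → Set
    f ≋ g = ∀ j → f j ≈ g j

    tail : Series → Series
    tail f j = f (suc j)

    const : ℤ → Series
    const c zero    = c
    const c (suc _) = + 0

    _⊕_ : Series → Series → Series
    (f ⊕ g) j = f j + g j

    _⊙_ : ℤ → Series → Series
    (c ⊙ f) j = c * f j

    -- Multiplication by s + t.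
    lin : ℤ → Series → Series
    lin s f zero    = s * f zero
    lin s f (suc j) = s * f (suc j) + f j

    _⊛_ : Series → Series → Series
    (f ⊛ g) zero    = f 0 * g 0
    (f ⊛ g) (suc j) = f 0 * g (suc j) + (tail f ⊛ g) j

    ⊛-cong : ∀ {f f′ g g′} → f ≋ f′ → g ≋ g′ → f ⊛ g ≋ f′ ⊛ g′
    ⊛-cong e h zero    = *-cong (e 0) (h 0)
    ⊛-cong e h (suc j) = +-cong (*-cong (e 0) (h (suc j))) (⊛-cong (λ i → e (suc i)) h j)

    lin-cong : ∀ s {f g} → f ≋ g → lin s f ≋ lin s g
    lin-cong s e zero    = *-cong (≈-refl {s}) (e 0)
    lin-cong s e (suc j) = +-cong (*-cong (≈-refl {s}) (e (suc j))) (e j)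

    lin-zero : ∀ s {f} → (∀ j → f j ≈ + 0) → ∀ j → lin s f j ≈ + 0
    lin-zero s e zero    = *-zeroʳ s (e 0)
    lin-zero s e (suc j) = +-zero (*-zeroʳ s (e (suc j))) (e j)

    ⊛-distribʳ : ∀ f g h j → ((f ⊕ g) ⊛ h) j ≡ (f ⊛ h) j + (g ⊛ h) j
    ⊛-distribʳ f g h zero    = ℤ.*-distribʳ-+ (h 0) (f 0) (g 0)
    ⊛-distribʳ f g h (suc j) = trans
      (cong (_+_ ((f 0 + g 0) * h (suc j))) (⊛-distribʳ (tail f) (tail g) h j))
      (identity (f 0) (g 0) (h (suc j)) _ _)
      where
      identity : ∀ a b c x y → (a + b) * c + (x + y) ≡ a * c + x + (b * c + y)
      identity = solve-∀

    ⊙-⊛ : ∀ c f g j → ((c ⊙ f) ⊛ g) j ≡ c * (f ⊛ g) j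
    ⊙-⊛ c f g zero    = ℤ.*-assoc c (f 0) (g 0)
    ⊙-⊛ c f g (suc j) = trans
      (cong (_+_ (c * f 0 * g (suc j))) (⊙-⊛ c (tail f) g j))
      (identity c (f 0) (g (suc j)) _)
      where
      identity : ∀ c a b x → c * a * b + c * x ≡ c * (a * b + x)
      identity = solve-∀

    0⊛ : ∀ g j → ((λ _ → + 0) ⊛ g) j ≡ + 0
    0⊛ g zero    = refl
    0⊛ g (suc j) = trans (ℤ.+-identityˡ _) (0⊛ g j)

    const-⊛ : ∀ c g j → (const c ⊛ g) j ≡ c * g j
    const-⊛ c g zero    = refl
    const-⊛ c g (suc j) = trans (cong (_+_ (c * g (suc j))) (0⊛ g j)) (ℤ.+-identityʳ _)

    lin-⊛ : ∀ s f g j → (lin s f ⊛ g) j ≡ lin s (f ⊛ g) j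
    lin-⊛ s f g zero    = ℤ.*-assoc s (f 0) (g 0)
    lin-⊛ s f g (suc j) = begin
      s * f 0 * g (suc j) + ((s ⊙ tail f ⊕ f) ⊛ g) j
        ≡⟨ cong (_+_ (s * f 0 * g (suc j))) (⊛-distribʳ (s ⊙ tail f) f g j) ⟩
      s * f 0 * g (suc j) + (((s ⊙ tail f) ⊛ g) j + (f ⊛ g) j)
        ≡⟨ cong (λ x → s * f 0 * g (suc j) + (x + (f ⊛ g) j)) (⊙-⊛ s (tail f) g j) ⟩
      s * f 0 * g (suc j) + (s * (tail f ⊛ g) j + (f ⊛ g) j)
        ≡⟨ identity s (f 0) (g (suc j)) _ _ ⟩
      s * (f 0 * g (suc j) + (tail f ⊛ g) j) + (f ⊛ g) j ∎
      where
      open ≡-Reasoning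
      identity : ∀ s a b x y → s * a * b + (s * x + y) ≡ s * (a * b + x) + y
      identity = solve-∀

    ⊛-vanish : ∀ f {g} j → (∀ i → i ℕ.≤ j → g i ≈ + 0) → (f ⊛ g) j ≈ + 0
    ⊛-vanish f zero    e = *-zeroʳ (f 0) (e 0 z≤n)
    ⊛-vanish f (suc j) e = +-zero (*-zeroʳ (f 0) (e (suc j) ℕ.≤-refl))
                                  (⊛-vanish (tail f) j λ i i≤j → e i (ℕ.m≤n⇒m≤1+n i≤j))

    -- The bound is strict: degree less than N, so that N = 0 leaves only the zero polynomial. The
    -- steps are Horner's scheme f = c + X f′, where X reads b + t at b. This is also what ties the
    -- expansions at different points to one polynomial.
    data Deg : ℕ → Poly → Set where
      zeroᵈ : ∀ {N f} → (∀ b j → f b j ≈ + 0) → Deg N f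
      stepᵈ : ∀ {N f f′} c → Deg N f′ → (∀ b j → f b j ≈ (const c ⊕ lin b (f′ b)) j) → Deg (suc N) f

    Deg-resp : ∀ {N f g} → (∀ b j → g b j ≈ f b j) → Deg N f → Deg N g
    Deg-resp e (zeroᵈ z)     = zeroᵈ λ b j → ≈-trans (e b j) (z b j)
    Deg-resp e (stepᵈ c d s) = stepᵈ c d λ b j → ≈-trans (e b j) (s b j)

    Deg-0 : ∀ {f} → Deg 0 f → ∀ b j → f b j ≈ + 0
    Deg-0 (zeroᵈ z) = z

    Deg-mono : ∀ {M N f} → M ℕ.≤ N → Deg M f → Deg N f
    Deg-mono M≤N       (zeroᵈ z)     = zeroᵈ z
    Deg-mono (s≤s M≤N) (stepᵈ c d s) = stepᵈ c (Deg-mono M≤N d) s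

    Deg-1 : ∀ {f} → Deg 1 f → ∃ λ c → ∀ b j → f b j ≈ const c j
    Deg-1 (zeroᵈ z)     = + 0 , λ where
      b zero    → z b 0
      b (suc j) → z b (suc j)
    Deg-1 (stepᵈ c d s) = c , λ b j → ≈-trans (s b j)
      (≈-trans (+-cong (≈-refl {const c j}) (lin-zero b (Deg-0 d b) j)) (≡⇒≈ (ℤ.+-identityʳ _)))

    Deg-⊕ : ∀ {N f g} → Deg N f → Deg N g → Deg N (λ b → f b ⊕ g b)
    Deg-⊕ {f = f} {g} (zeroᵈ z) d = Deg-resp (λ b j → ≈-trans (+-cong (z b j) (≈-refl {g b j})) (≡⇒≈ (ℤ.+-identityˡ _))) d
    Deg-⊕ {f = f} {g} d@(stepᵈ _ _ _) (zeroᵈ z) =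
      Deg-resp (λ b j → ≈-trans (+-cong (≈-refl {f b j}) (z b j)) (≡⇒≈ (ℤ.+-identityʳ _))) d
    Deg-⊕ {f = f} {g} (stepᵈ {f′ = f′} c d s) (stepᵈ {f′ = g′} c′ d′ s′) =
      stepᵈ (c + c′) (Deg-⊕ d d′) λ b j → ≈-trans (+-cong (s b j) (s′ b j)) (≡⇒≈ (rearrange b j))
      where
      identity₀ : ∀ c c′ b x y → c + b * x + (c′ + b * y) ≡ c + c′ + b * (x + y)
      identity₀ = solve-∀
      identity₁ : ∀ b x y u v → + 0 + (b * x + u) + (+ 0 + (b * y + v)) ≡ + 0 + (b * (x + y) + (u + v))
      identity₁ = solve-∀
      rearrange : ∀ b j → (const c ⊕ lin b (f′ b)) j + (const c′ ⊕ lin b (g′ b)) j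
                        ≡ (const (c + c′) ⊕ lin b (f′ b ⊕ g′ b)) j
      rearrange b zero    = identity₀ c c′ b _ _
      rearrange b (suc j) = identity₁ b (f′ b (suc j)) (g′ b (suc j)) (f′ b j) (g′ b j)

    Deg-⊙ : ∀ {N f} a → Deg N f → Deg N (λ b → a ⊙ f b)
    Deg-⊙ a (zeroᵈ z) = zeroᵈ λ b j → *-zeroʳ a (z b j)
    Deg-⊙ {f = f} a (stepᵈ {f′ = f′} c d s) =
      stepᵈ (a * c) (Deg-⊙ a d) λ b j → ≈-trans (*-cong (≈-refl {a}) (s b j)) (≡⇒≈ (rearrange b j))
      where
      identity₀ : ∀ a c b x → a * (c + b * x) ≡ a * c + b * (a * x)
      identity₀ = solve-∀
      identity₁ : ∀ a b x u → a * (+ 0 + (b * x + u)) ≡ + 0 + (b * (a * x) + a * u)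
      identity₁ = solve-∀
      rearrange : ∀ b j → a * (const c ⊕ lin b (f′ b)) j ≡ (const (a * c) ⊕ lin b (a ⊙ f′ b)) j
      rearrange b zero    = identity₀ a c b _
      rearrange b (suc j) = identity₁ a b _ _

    Deg-X : ∀ {N f} → Deg N f → Deg (suc N) (λ b → lin b (f b))
    Deg-X d = stepᵈ (+ 0) d λ where
      b zero    → ≡⇒≈ (sym (ℤ.+-identityˡ _))
      b (suc j) → ≡⇒≈ (sym (ℤ.+-identityˡ _))

    Deg-lin : ∀ {N f} a → Deg N f → Deg (suc N) (λ b → lin (b + a) (f b))
    Deg-lin {f = f} a d = Deg-resp rearrange (Deg-⊕ (Deg-X d) (Deg-⊙ a (Deg-mono (ℕ.n≤1+n _) d)))
      where
      identity₀ : ∀ b a x → (b + a) * x ≡ b * x + a * x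
      identity₀ = solve-∀
      identity₁ : ∀ b a x u → (b + a) * x + u ≡ b * x + u + a * x
      identity₁ = solve-∀
      rearrange : ∀ b j → lin (b + a) (f b) j ≈ (lin b (f b) ⊕ a ⊙ f b) j
      rearrange b zero    = ≡⇒≈ (identity₀ b a _)
      rearrange b (suc j) = ≡⇒≈ (identity₁ b a _ _)

    const-Deg : ∀ c → Deg 1 (λ _ → const c)
    const-Deg c = stepᵈ {f′ = λ _ _ → + 0} c (zeroᵈ λ _ _ → ≈-refl) expand
      where
      identity₀ : ∀ c b → c ≡ c + b * + 0
      identity₀ = solve-∀
      identity₁ : ∀ b → + 0 ≡ + 0 + (b * + 0 + + 0)
      identity₁ = solve-∀
      expand : ∀ b j → const c j ≈ (const c ⊕ lin b (λ _ → + 0)) j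
      expand b zero    = ≡⇒≈ (identity₀ c b)
      expand b (suc j) = ≡⇒≈ (identity₁ b)

    -- With strict bounds, degrees at most N and at most M - 1 add up to less than N + M; hence the
    -- successor on one factor only.
    Deg-⊛ : ∀ {N M f g} → Deg (suc N) f → Deg M g → Deg (N ℕ.+ M) (λ b → f b ⊛ g b)
    Deg-⊛ {g = g} (zeroᵈ z) _ =
      zeroᵈ λ b j → ≈-trans (⊛-cong (z b) (λ i → ≈-refl {g b i}) j) (≡⇒≈ (0⊛ (g b) j))
    Deg-⊛ {N} {M} {f} {g} (stepᵈ {f′ = f′} c d s) e =
      Deg-resp expand (Deg-⊕ (Deg-mono (ℕ.m≤n+m M N) (Deg-⊙ c e)) (X-part N d))
      where
      expand : ∀ b j → (f b ⊛ g b) j ≈ (c ⊙ g b ⊕ lin b (f′ b ⊛ g b)) j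
      expand b j = ≈-trans (⊛-cong (s b) (λ i → ≈-refl {g b i}) j) (≡⇒≈ (trans
        (⊛-distribʳ (const c) (lin b (f′ b)) (g b) j)
        (cong₂ _+_ (const-⊛ c (g b) j) (lin-⊛ b (f′ b) (g b) j))))
      X-part : ∀ N → Deg N f′ → Deg (N ℕ.+ M) (λ b → lin b (f′ b ⊛ g b))
      X-part zero    (zeroᵈ z) = zeroᵈ λ b → lin-zero b λ j →
        ≈-trans (⊛-cong (z b) (λ i → ≈-refl {g b i}) j) (≡⇒≈ (0⊛ (g b) j))
      X-part (suc N) d = Deg-X (Deg-⊛ d e)

    ∂ : Poly → Poly
    ∂ f b j = + suc j * f b (suc j)

    Deg-∂ : ∀ {N f} → Deg (suc N) f → Deg N (∂ f)
    Deg-∂ (zeroᵈ z) = zeroᵈ λ b j → *-zeroʳ (+ suc j) (z b (suc j))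
    Deg-∂ {N} {f} (stepᵈ {f′ = f′} c d s) = Deg-resp expand (Deg-⊕ d (X-part N d))
      where
      identity₀ : ∀ b x y → + 1 * (+ 0 + (b * x + y)) ≡ y + b * (+ 1 * x)
      identity₀ = solve-∀
      identity₁ : ∀ k b x y → (+ 2 + k) * (+ 0 + (b * x + y)) ≡ y + (b * ((+ 2 + k) * x) + (+ 1 + k) * y)
      identity₁ = solve-∀
      expand : ∀ b j → ∂ f b j ≈ (f′ b ⊕ lin b (∂ f′ b)) j
      expand b zero    = ≈-trans (*-cong (≈-refl {+ 1}) (s b 1)) (≡⇒≈ (identity₀ b _ _))
      expand b (suc j) = ≈-trans (*-cong (≈-refl {+ suc (suc j)}) (s b (suc (suc j))))
                                 (≡⇒≈ (identity₁ (+ j) b _ _))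
      X-part : ∀ N → Deg N f′ → Deg N (λ b → lin b (∂ f′ b))
      X-part zero    (zeroᵈ z) = zeroᵈ λ b → lin-zero b λ j → *-zeroʳ (+ suc j) (z b (suc j))
      X-part (suc N) d = Deg-X (Deg-∂ d)

    -- The coefficients at 0 are the Horner constants, so peeling them off one by one shows that the
    -- expansion at 0 determines all others.
    Deg-vanish : ∀ {N f} → Deg N f → f (+ 0) ≋ (λ _ → + 0) → ∀ b j → f b j ≈ + 0
    Deg-vanish (zeroᵈ z) e = z
    Deg-vanish {f = f} (stepᵈ {f′ = f′} c d s) e b j =
      ≈-trans (s b j) (≈-trans (+-cong (const≈0 j) (lin-zero b (Deg-vanish d f′≈0 b) j)) ≈-refl)
      where
      c≈0 : c ≈ + 0
      c≈0 = ≈-trans (≡⇒≈ (sym (ℤ.+-identityʳ c))) (≈-trans (≈-sym (s (+ 0) 0)) (e 0))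
      const≈0 : ∀ j → const c j ≈ + 0
      const≈0 zero    = c≈0
      const≈0 (suc _) = ≈-refl
      f′≈0 : f′ (+ 0) ≋ (λ _ → + 0)
      f′≈0 j = ≈-trans (≡⇒≈ (sym (trans (ℤ.+-identityˡ _) (ℤ.+-identityˡ _)))) (≈-trans (≈-sym (s (+ 0) (suc j))) (e (suc j)))

  -- Roots, multiplicities and factorisation modulo p

  module Factorisation (p : ℕ) (prime : Prime p) where

    open Polynomials p public

    Distinct : List ℤ → Set
    Distinct = AllPairs _≉_

    -- Synthetic division by X + a, whose root is -a: the quotient is assembled from the Horner
    -- layers of f evaluated at -a.
    divide : ∀ {N f} → Deg N f → ∀ a → ∃ λ h → Deg (N ℕ.∸ 1) h ×
             (∀ b j → f b j ≈ (const (f (- a) 0) ⊕ lin (b + a) (h b)) j)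
    divide {f = f} (zeroᵈ z) a = (λ _ _ → + 0) , zeroᵈ (λ _ _ → ≈-refl) , expand
      where
      expand : ∀ b j → f b j ≈ (const (f (- a) 0) ⊕ lin (b + a) (λ _ → + 0)) j
      expand b zero    = ≈-trans (z b 0) (≈-sym (+-zero (z (- a) 0) (lin-zero (b + a) (λ _ → ≈-refl) 0)))
      expand b (suc j) = ≈-trans (z b (suc j)) (≈-sym (+-zero ≈-refl (lin-zero (b + a) (λ _ → ≈-refl) (suc j))))
    divide {f = f} (stepᵈ {N} {f′ = f′} c d s) a with divide d a
    ... | h , dh , eq = (λ b → const e ⊕ lin b (h b)) , quotient-Deg N d dh , expand
      where
      e : ℤ
      e = f′ (- a) 0
      quotient-Deg : ∀ N → Deg N f′ → Deg (N ℕ.∸ 1) h → Deg N (λ b → const e ⊕ lin b (h b))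
      quotient-Deg zero d dh = zeroᵈ λ where
        b zero    → +-zero (Deg-0 d (- a) 0) (lin-zero b (Deg-0 dh b) 0)
        b (suc j) → +-zero ≈-refl (lin-zero b (Deg-0 dh b) (suc j))
      quotient-Deg (suc N) d dh = stepᵈ e dh λ _ _ → ≈-refl
      identity₀ : ∀ c b a e h → c + b * (e + (b + a) * h) ≡ c + - a * e + (b + a) * (e + b * h)
      identity₀ = solve-∀
      identity₁ : ∀ b a e h h₁ → + 0 + (b * (+ 0 + ((b + a) * h₁ + h)) + (e + (b + a) * h))
                               ≡ + 0 + ((b + a) * (+ 0 + (b * h₁ + h)) + (e + b * h))
      identity₁ = solve-∀
      identity₂ : ∀ b a h h₁ h₂ →
        + 0 + (b * (+ 0 + ((b + a) * h₂ + h₁)) + (+ 0 + ((b + a) * h₁ + h)))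
        ≡ + 0 + ((b + a) * (+ 0 + (b * h₂ + h₁)) + (+ 0 + (b * h₁ + h)))
      identity₂ = solve-∀
      rearrange : ∀ b j → (const c ⊕ lin b (const e ⊕ lin (b + a) (h b))) j
                        ≡ (const (c + - a * e) ⊕ lin (b + a) (const e ⊕ lin b (h b))) j
      rearrange b zero          = identity₀ c b a e _
      rearrange b (suc zero)    = identity₁ b a e _ _
      rearrange b (suc (suc j)) = identity₂ b a _ _ _
      const-cong : ∀ {x y} j → x ≈ y → const x j ≈ const y j
      const-cong zero    e = e
      const-cong (suc _) _ = ≈-refl
      expand : ∀ b j → f b j ≈ (const (f (- a) 0) ⊕ lin (b + a) (const e ⊕ lin b (h b))) j
      expand b j = ≈-trans (s b j)
        (≈-trans (+-cong (≈-refl {const c j}) (lin-cong b (eq b) j))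
        (≈-trans (≡⇒≈ (rearrange b j))
        (+-cong (const-cong j (≈-sym (s (- a) 0))) (≈-refl {lin (b + a) (const e ⊕ lin b (h b)) j}))))

    ∏ : List ℤ → Poly
    ∏ []      b = const (+ 1)
    ∏ (a ∷ L) b = lin (b + a) (∏ L b)

    ∏-Deg : ∀ L → Deg (suc (length L)) (∏ L)
    ∏-Deg []      = const-Deg (+ 1)
    ∏-Deg (a ∷ L) = Deg-lin a (∏-Deg L)

    difference≉0 : ∀ {a c} → a ≉ c → - c + a ≉ + 0
    difference≉0 {a} {c} a≉c e = a≉c (combine₁ (+ 1) e (identity a c))
      where
      identity : ∀ a c → a - c ≡ + 1 * (- c + a - + 0)
      identity = solve-∀

    -c+c≈0 : ∀ c → - c + c ≈ + 0
    -c+c≈0 c = ≡⇒≈ (ℤ.+-inverseˡ c)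

    1≉0 : + 1 ≉ + 0
    1≉0 e = ℕ.>⇒≢ (ℕ.nonTrivial⇒n>1 p {{prime⇒nonTrivial prime}}) (ℕ.∣1⇒≡1 (≈0⇒∣ e))

    ∏-value≉0 : ∀ b L → All (λ a → b + a ≉ + 0) L → ∏ L b 0 ≉ + 0
    ∏-value≉0 b []      []       = 1≉0
    ∏-value≉0 b (a ∷ L) (n ∷ ns) = *-≉0 prime n (∏-value≉0 b L ns)

    SimpleRoot : Series → Set
    SimpleRoot f = f 0 ≈ + 0 × f 1 ≉ + 0

    lin-root : ∀ s f → s ≈ + 0 → f 0 ≉ + 0 → SimpleRoot (lin s f)
    lin-root s f s≈0 f0≉0 = *-zeroˡ (f 0) s≈0 , λ e → f0≉0 (combine₂ (+ 1) (- f 1) e s≈0 (identity s (f 1) (f 0)))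
      where
      identity : ∀ s x y → y - + 0 ≡ + 1 * (s * x + y - + 0) + - x * (s - + 0)
      identity = solve-∀

    lin-simpleRoot : ∀ s f → s ≉ + 0 → SimpleRoot f → SimpleRoot (lin s f)
    lin-simpleRoot s f s≉0 (f0≈0 , f1≉0) = *-zeroʳ s f0≈0 , λ e →
      f1≉0 (cancel-zero prime s≉0 (combine₂ (+ 1) (- + 1) e f0≈0 (identity s (f 1) (f 0))))
      where
      identity : ∀ s x y → s * x - + 0 ≡ + 1 * (s * x + y - + 0) + - + 1 * (y - + 0)
      identity = solve-∀

    -- At the root of the new factor the remaining product is nonzero, and at the old roots the new
    -- factor is nonzero.
    ∏-simpleRoots : ∀ {L} → Distinct L → All (λ c → SimpleRoot (∏ L (- c))) L
    ∏-simpleRoots []                          = []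
    ∏-simpleRoots (_∷_ {a} {L} a∉L distinct) =
      lin-root (- a + a) (∏ L (- a)) (-c+c≈0 a)
        (∏-value≉0 (- a) L (All.map (λ a≉c → difference≉0 (a≉c ∘ ≈-sym)) a∉L))
      ∷ All.zipWith (λ { {c} (a≉c , root) → lin-simpleRoot (- c + a) (∏ L (- c)) (difference≉0 a≉c) root })
          (a∉L , ∏-simpleRoots distinct)

    factor : ∀ {N f C} → Deg N f → Distinct C → All (λ c → f (- c) 0 ≈ + 0) C →
             ∃ λ h → Deg (N ℕ.∸ length C) h × (∀ b j → f b j ≈ (∏ C b ⊛ h b) j)
    factor {f = f} d [] [] = f , d , λ b j → ≡⇒≈ (sym (trans (const-⊛ (+ 1) (f b) j) (ℤ.*-identityˡ _)))
    factor {N} {f} d (_∷_ {c} {C} c∉C distinct) (root ∷ roots) with divide d c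
    ... | h , dh , eq with factor dh distinct (All.zipWith root-of-quotient (c∉C , roots))
      where
      root-of-quotient : ∀ {c′} → (c ≉ c′ × f (- c′) 0 ≈ + 0) → h (- c′) 0 ≈ + 0
      root-of-quotient {c′} (c≉c′ , r) = cancel-zero prime (difference≉0 c≉c′)
        (combine₃ (- + 1) (+ 1) (- + 1) (eq (- c′) 0) r root
          (identity ((- c′ + c) * h (- c′) 0) (f (- c′) 0) (f (- c) 0)))
        where
        identity : ∀ x y z → x - + 0 ≡ - + 1 * (y - (z + x)) + + 1 * (y - + 0) + - + 1 * (z - + 0)
        identity = solve-∀
    ... | k , dk , eq′ = k , subst (λ M → Deg M k) (ℕ.∸-+-assoc N 1 (length C)) dk , expand
      where
      const≈0 : ∀ j → const (f (- c) 0) j ≈ + 0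
      const≈0 zero    = root
      const≈0 (suc _) = ≈-refl
      expand : ∀ b j → f b j ≈ (∏ (c ∷ C) b ⊛ k b) j
      expand b j = ≈-trans (eq b j)
        (≈-trans (+-cong (const≈0 j) (lin-cong (b + c) (eq′ b) j))
        (≡⇒≈ (trans (ℤ.+-identityˡ _) (sym (lin-⊛ (b + c) (∏ C b) (k b) j)))))

    ∏^ : ℕ → List ℤ → Poly → Poly
    ∏^ zero    C h b = h b
    ∏^ (suc m) C h b = ∏ C b ⊛ ∏^ m C h b

    -- The constant term of `u` is invertible, so the equations form a triangular system, solved for
    -- the coefficients of `w` from the lowest one up.
    ⊛-cancel-unit : ∀ {u w} m → u 0 ≉ + 0 → (∀ j → j ℕ.< m → (u ⊛ w) j ≈ + 0) → ∀ j → j ℕ.< m → w j ≈ + 0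
    ⊛-cancel-unit {u} {w} (suc m) u≉0 e j (s≤s j≤m) with ℕ.m≤n⇒m<n∨m≡n j≤m
    ... | inj₁ j<m  = ⊛-cancel-unit m u≉0 (λ i i<m → e i (ℕ.m<n⇒m<1+n i<m)) j j<m
    ... | inj₂ refl = cancel-zero prime u≉0 (leading j refl)
      where
      below : ∀ i → i ℕ.< m → w i ≈ + 0
      below = ⊛-cancel-unit m u≉0 (λ i i<m → e i (ℕ.m<n⇒m<1+n i<m))
      identity : ∀ x y → x - + 0 ≡ + 1 * (x + y - + 0) + - + 1 * (y - + 0)
      identity = solve-∀
      leading : ∀ i → i ≡ m → u 0 * w i ≈ + 0
      leading zero    refl = e 0 (s≤s z≤n)
      leading (suc i) refl = combine₂ (+ 1) (- + 1) (e (suc i) ℕ.≤-refl)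
        (⊛-vanish (tail u) i λ k k≤i → below k (s≤s k≤i)) (identity (u 0 * w (suc i)) ((tail u ⊛ w) i))

    -- One copy of ∏ C is divided out at a time. Each root is simple in ∏ C, which there is t times
    -- a unit, so the order of vanishing of the quotient drops by only one.
    factor-power : ∀ m {N f C} → Deg N f → Distinct C → All (λ c → ∀ j → j ℕ.< m → f (- c) j ≈ + 0) C →
                   ∃ λ h → Deg (N ℕ.∸ m ℕ.* length C) h × (∀ b j → f b j ≈ ∏^ m C h b j)
    factor-power zero    {f = f} d distinct roots = f , d , λ _ _ → ≈-refl
    factor-power (suc m) {N} {f} {C} d distinct roots
      with factor d distinct (All.map (λ r → r 0 (s≤s z≤n)) roots)
    ... | h , dh , eq with factor-power m dh distinct (All.zipWith quotient-order (∏-simpleRoots distinct , roots))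
      where
      quotient-order : ∀ {c} → SimpleRoot (∏ C (- c)) × (∀ j → j ℕ.< suc m → f (- c) j ≈ + 0) →
                       ∀ j → j ℕ.< m → h (- c) j ≈ + 0
      quotient-order {c} ((g0≈0 , g1≉0) , r) = ⊛-cancel-unit {tail (∏ C (- c))} m g1≉0 λ j j<m →
        combine₃ (- + 1) (+ 1) (- h (- c) (suc j)) (eq (- c) (suc j)) (r (suc j) (s≤s j<m)) g0≈0
          (identity ((tail (∏ C (- c)) ⊛ h (- c)) j) (f (- c) (suc j)) (∏ C (- c) 0) (h (- c) (suc j)))
        where
        identity : ∀ x y g k → x - + 0 ≡ - + 1 * (y - (g * k + x)) + + 1 * (y - + 0) + - k * (g - + 0)
        identity = solve-∀
    ... | k , dk , eq′ = k , subst (λ M → Deg M k) (ℕ.∸-+-assoc N (length C) (m ℕ.* length C)) dk ,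
      λ b j → ≈-trans (eq b j) (⊛-cong (λ i → ≈-refl {∏ C b i}) (eq′ b) j)

    shift : Series → Series
    shift f zero    = + 0
    shift f (suc j) = f j

    ⊛-shift : ∀ f g j → (f ⊛ shift g) j ≡ shift (f ⊛ g) j
    ⊛-shift f g zero          = ℤ.*-zeroʳ (f 0)
    ⊛-shift f g (suc zero)    = trans (cong (_+_ (f 0 * g 0)) (ℤ.*-zeroʳ (f 1))) (ℤ.+-identityʳ _)
    ⊛-shift f g (suc (suc j)) = cong (_+_ (f 0 * g (suc j))) (⊛-shift (tail f) g (suc j))

    _^⊛_ : Series → ℕ → Series → Series
    (u ^⊛ zero)  f = f
    (u ^⊛ suc m) f = u ⊛ (u ^⊛ m) f

    shift^ : ℕ → Series → Series
    shift^ zero    f = f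
    shift^ (suc m) f = shift (shift^ m f)

    shift^-+ : ∀ m f s → shift^ m f (m ℕ.+ s) ≡ f s
    shift^-+ zero    f s = refl
    shift^-+ (suc m) f s = shift^-+ m f s

    ⊛-shift^ : ∀ m f g j → (f ⊛ shift^ m g) j ≈ shift^ m (f ⊛ g) j
    ⊛-shift^ zero    f g j = ≈-refl
    ⊛-shift^ (suc m) f g zero    = ≡⇒≈ (⊛-shift f (shift^ m g) zero)
    ⊛-shift^ (suc m) f g (suc j) = ≈-trans (≡⇒≈ (⊛-shift f (shift^ m g) (suc j))) (⊛-shift^ m f g j)

    -- At a root, ∏ C is t times its `tail`, and the m factors t come out as a shift.
    ∏^-expansion : ∀ m C h b → ∏ C b 0 ≈ + 0 → ∏^ m C h b ≋ shift^ m ((tail (∏ C b) ^⊛ m) (h b))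
    ∏^-expansion zero    C h b root j       = ≈-refl
    ∏^-expansion (suc m) C h b root zero    = *-zeroˡ (∏^ m C h b 0) root
    ∏^-expansion (suc m) C h b root (suc j) = ≈-trans
      (≈-trans (+-cong (*-zeroˡ (∏^ m C h b (suc j)) root) ≈-refl) (≡⇒≈ (ℤ.+-identityˡ _)))
      (≈-trans (⊛-cong (λ i → ≈-refl {∏ C b (suc i)}) (∏^-expansion m C h b root) j)
               (⊛-shift^ m (tail (∏ C b)) _ j))

    -- The lowest two coefficients of u v′ = m u′ v for v = uᵐ f.
    module PowerCoefficients (u f : Series) (f1≈0 : f 1 ≈ + 0) (f2≈0 : f 2 ≈ + 0) where

      first : ∀ m → u 0 * (u ^⊛ m) f 1 ≈ + m * u 1 * (u ^⊛ m) f 0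
      first zero    = *-zeroʳ (u 0) f1≈0
      first (suc m) = combine₁ (u 0) (first m) (identity (+ m) (u 0) (u 1) _ _)
        where
        identity : ∀ m u₀ u₁ v₀ v₁ → u₀ * (u₀ * v₁ + u₁ * v₀) - (+ 1 + m) * u₁ * (u₀ * v₀)
                                   ≡ u₀ * (u₀ * v₁ - m * u₁ * v₀)
        identity = solve-∀

      second : ∀ m → + 2 * u 0 * (u ^⊛ m) f 2
                   ≈ (+ m - + 1) * u 1 * (u ^⊛ m) f 1 + + 2 * + m * u 2 * (u ^⊛ m) f 0
      second zero    = combine₂ (+ 2 * u 0) (u 1) f2≈0 f1≈0 (identity (u 0) (u 1) (u 2) (f 0) (f 1) (f 2))
        where
        identity : ∀ u₀ u₁ u₂ v₀ v₁ v₂ →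
          + 2 * u₀ * v₂ - ((+ 0 - + 1) * u₁ * v₁ + + 2 * + 0 * u₂ * v₀) ≡ + 2 * u₀ * (v₂ - + 0) + u₁ * (v₁ - + 0)
        identity = solve-∀
      second (suc m) = combine₂ (u 0) (u 1) (second m) (first m) (identity (+ m) (u 0) (u 1) (u 2) _ _ _)
        where
        identity : ∀ m u₀ u₁ u₂ v₀ v₁ v₂ →
          + 2 * u₀ * (u₀ * v₂ + (u₁ * v₁ + u₂ * v₀))
            - ((+ 1 + m - + 1) * u₁ * (u₀ * v₁ + u₁ * v₀) + + 2 * (+ 1 + m) * u₂ * (u₀ * v₀))
          ≡ u₀ * (+ 2 * u₀ * v₂ - ((m - + 1) * u₁ * v₁ + + 2 * m * u₂ * v₀)) + u₁ * (u₀ * v₁ - m * u₁ * v₀)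
        identity = solve-∀

      leading≉0 : ∀ m → u 0 ≉ + 0 → f 0 ≉ + 0 → (u ^⊛ m) f 0 ≉ + 0
      leading≉0 zero    u≉0 f≉0 = f≉0
      leading≉0 (suc m) u≉0 f≉0 = *-≉0 prime u≉0 (leading≉0 m u≉0 f≉0)

  -- Binomial coefficients and divided differences of powers

  binomial : ℕ → ℕ → ℤ
  binomial n k = + choose n k

  binomial-pascal : ∀ n k → binomial (suc n) (suc k) ≡ binomial n k + binomial n (suc k)
  binomial-pascal n k = trans (cong +_ (sym (nCk+nC[k+1]≡[n+1]C[k+1] n k))) (ℤ.pos-+ (choose n k) _)

  -- Subtracting in the integers makes this hold for every k: at k = n the right factor is zero, and
  -- beyond that both binomials are. It supplies the ratios of the binomials in successive
  -- coefficients of F.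
  binomial-suc : ∀ n k → + suc k * binomial n (suc k) ≡ (+ n - + k) * binomial n k
  binomial-suc zero zero = refl
  binomial-suc zero (suc k) = trans (trans (cong (λ x → + suc (suc k) * + x) (k>n⇒nCk≡0 {0} {suc (suc k)} (s≤s z≤n))) (ℤ.*-zeroʳ (+ suc (suc k))))
    (sym (trans (cong (λ x → (+ 0 - + suc k) * + x) (k>n⇒nCk≡0 {0} {suc k} (s≤s z≤n))) (ℤ.*-zeroʳ (+ 0 - + suc k))))
  binomial-suc (suc n) zero = trans (ℤ.*-identityˡ _) (trans (cong +_ (nC1≡n (suc n))) (identity (+ n)))
    where
    identity : ∀ n → + 1 + n ≡ (+ 1 + n - + 0) * + 1
    identity = solve-∀
  binomial-suc (suc n) (suc k) = begin
    (+ 2 + + k) * binomial (suc n) (suc (suc k))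
      ≡⟨ cong ((+ 2 + + k) *_) (binomial-pascal n (suc k)) ⟩
    (+ 2 + + k) * (x + y)
      ≡⟨ identity₀ (+ k) x y ⟩
    (+ 2 + + k) * x + (+ 2 + + k) * y
      ≡⟨ cong (_+_ ((+ 2 + + k) * x)) (binomial-suc n (suc k)) ⟩
    (+ 2 + + k) * x + (+ n - (+ 1 + + k)) * x
      ≡⟨ identity₁ (+ k) (+ n) x ⟩
    (+ 1 + + k) * x + (+ n - + k) * x
      ≡⟨ cong (_+ (+ n - + k) * x) (binomial-suc n k) ⟩
    (+ n - + k) * w + (+ n - + k) * x
      ≡⟨ identity₂ (+ k) (+ n) w x ⟩
    (+ 1 + + n - (+ 1 + + k)) * (w + x)
      ≡⟨ cong ((+ suc n - + suc k) *_) (sym (binomial-pascal n k)) ⟩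
    (+ suc n - + suc k) * binomial (suc n) (suc k) ∎
    where
    open ≡-Reasoning
    w x y : ℤ
    w = binomial n k
    x = binomial n (suc k)
    y = binomial n (suc (suc k))
    identity₀ : ∀ k x y → (+ 2 + k) * (x + y) ≡ (+ 2 + k) * x + (+ 2 + k) * y
    identity₀ = solve-∀
    identity₁ : ∀ k n x → (+ 2 + k) * x + (n - (+ 1 + k)) * x ≡ (+ 1 + k) * x + (n - k) * x
    identity₁ = solve-∀
    identity₂ : ∀ k n w x → (n - k) * w + (n - k) * x ≡ (+ 1 + n - (+ 1 + k)) * (w + x)
    identity₂ = solve-∀

  -- The constant function y⁰ has divided difference 1 at a single point and 0 at more; the argument
  -- lists the points after the first.
  initial : List ℤ → ℤ
  initial []      = + 1
  initial (_ ∷ _) = + 0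

  -- The divided difference of the function y ↦ yᵏ at the given points.
  dd : List ℤ → ℕ → ℤ
  dd []      k       = + 0
  dd (s ∷ L) zero    = initial L
  dd (s ∷ L) (suc k) = dd L k + s * dd (s ∷ L) k

  -- The recursion defining `dd` is free of division, so it also makes sense for the polynomial
  -- points X + a. This lemma recovers the usual quotient formula, on which periodicity rests.
  dd-recurrence : ∀ s s′ L k → (s - s′) * dd (s ∷ s′ ∷ L) k ≡ dd (s ∷ L) k - dd (s′ ∷ L) k
  dd-recurrence s s′ L zero = identity (s - s′) (initial L)
    where
    identity : ∀ x y → x * + 0 ≡ y - y
    identity = solve-∀
  dd-recurrence s s′ L (suc k) = begin
    (s - s′) * (dd (s′ ∷ L) k + s * dd (s ∷ s′ ∷ L) k)
      ≡⟨ identity₀ s s′ _ _ ⟩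
    (s - s′) * dd (s′ ∷ L) k + s * ((s - s′) * dd (s ∷ s′ ∷ L) k)
      ≡⟨ cong (λ x → (s - s′) * dd (s′ ∷ L) k + s * x) (dd-recurrence s s′ L k) ⟩
    (s - s′) * dd (s′ ∷ L) k + s * (dd (s ∷ L) k - dd (s′ ∷ L) k)
      ≡⟨ identity₁ s s′ (dd L k) _ _ ⟩
    dd L k + s * dd (s ∷ L) k - (dd L k + s′ * dd (s′ ∷ L) k) ∎
    where
    open ≡-Reasoning
    identity₀ : ∀ s s′ x y → (s - s′) * (x + s * y) ≡ (s - s′) * x + s * ((s - s′) * y)
    identity₀ = solve-∀
    identity₁ : ∀ s s′ z x y → (s - s′) * y + s * (x - y) ≡ z + s * x - (z + s′ * y)
    identity₁ = solve-∀

  -- `dd L k` is the complete homogeneous symmetric polynomial of degree k + 1 - |L| in the points: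
  -- zero in negative degree, and one in degree 0, which is `dd-leading`.
  dd-low : ∀ L k → suc k ℕ.< length L → dd L k ≡ + 0
  dd-low (s ∷ _ ∷ _) zero    _       = refl
  dd-low (s ∷ [])    zero    (s≤s ())
  dd-low (s ∷ L)     (suc k) (s≤s l) = begin
    dd L k + s * dd (s ∷ L) k ≡⟨ cong₂ (λ x y → x + s * y) (dd-low L k l) (dd-low (s ∷ L) k (ℕ.m<n⇒m<1+n l)) ⟩
    + 0 + s * + 0             ≡⟨ trans (ℤ.+-identityˡ _) (ℤ.*-zeroʳ s) ⟩
    + 0                       ∎
    where open ≡-Reasoning

  dd-leading : ∀ L k → suc k ≡ length L → dd L k ≡ + 1
  dd-leading (s ∷ [])    zero    _ = refl
  dd-leading (s ∷ _ ∷ _) zero    ()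
  dd-leading (s ∷ L)     (suc k) e = begin
    dd L k + s * dd (s ∷ L) k ≡⟨ cong₂ (λ x y → x + s * y) (dd-leading L k (ℕ.suc-injective e))
                                  (dd-low (s ∷ L) k (ℕ.≤-reflexive e)) ⟩
    + 1 + s * + 0             ≡⟨ cong (_+_ (+ 1)) (ℤ.*-zeroʳ s) ⟩
    + 1                       ∎
    where open ≡-Reasoning

  dd-singleton : ∀ s k → dd (s ∷ []) k ≡ s ^ k
  dd-singleton s zero    = refl
  dd-singleton s (suc k) = trans (ℤ.+-identityˡ _) (cong (s *_) (dd-singleton s k))

  -- The auxiliary polynomial and the bound |A| |C| ≤ q

  module HansonPetridis (p : ℕ) (prime : Prime p) (q : ℕ) where

    open Factorisation p prime public

    -- The divided difference of y ↦ yᵏ at the points X + a.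
    ddᵖ : List ℤ → ℕ → Poly
    ddᵖ []      k       b j = + 0
    ddᵖ (a ∷ L) zero    b   = const (initial L)
    ddᵖ (a ∷ L) (suc k) b   = ddᵖ L k b ⊕ lin (b + a) (ddᵖ (a ∷ L) k b)

    initial-map : ∀ (f : ℤ → ℤ) L → initial (map f L) ≡ initial L
    initial-map f []      = refl
    initial-map f (_ ∷ _) = refl

    -- Moving all points by t turns yᵏ into (y + t)ᵏ; the binomial theorem and linearity of divided
    -- differences give the coefficient of tʲ.
    ddᵖ-coefficient : ∀ L k b j → ddᵖ L k b j ≡ binomial k j * dd (map (_+_ b) L) (k ℕ.∸ j)
    ddᵖ-coefficient [] k b j = sym (ℤ.*-zeroʳ (binomial k j))
    ddᵖ-coefficient (a ∷ L) zero b zero = sym (trans (ℤ.*-identityˡ _) (initial-map (_+_ b) L))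
    ddᵖ-coefficient (a ∷ L) zero b (suc j) =
      sym (cong (λ x → + x * initial (map (_+_ b) L)) (k>n⇒nCk≡0 {0} {suc j} (s≤s z≤n)))
    ddᵖ-coefficient (a ∷ L) (suc k) b zero = begin
      ddᵖ L k b 0 + (b + a) * ddᵖ (a ∷ L) k b 0
        ≡⟨ cong₂ (λ x y → x + (b + a) * y) (ddᵖ-coefficient L k b 0) (ddᵖ-coefficient (a ∷ L) k b 0) ⟩
      + 1 * dd (map (_+_ b) L) k + (b + a) * (+ 1 * dd (map (_+_ b) (a ∷ L)) k)
        ≡⟨ identity (b + a) (dd (map (_+_ b) L) k) (dd (map (_+_ b) (a ∷ L)) k) ⟩
      + 1 * (dd (map (_+_ b) L) k + (b + a) * dd (map (_+_ b) (a ∷ L)) k) ∎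
      where
      open ≡-Reasoning
      identity : ∀ s x y → + 1 * x + s * (+ 1 * y) ≡ + 1 * (x + s * y)
      identity = solve-∀
    ddᵖ-coefficient (a ∷ L) (suc k) b (suc j) = begin
      ddᵖ L k b (suc j) + (s * ddᵖ (a ∷ L) k b (suc j) + ddᵖ (a ∷ L) k b j)
        ≡⟨ cong₂ _+_ (ddᵖ-coefficient L k b (suc j))
            (cong₂ (λ x y → s * x + y) (ddᵖ-coefficient (a ∷ L) k b (suc j)) (ddᵖ-coefficient (a ∷ L) k b j)) ⟩
      binomial k (suc j) * dd L′ (k ℕ.∸ suc j) +
        (s * (binomial k (suc j) * dd (s ∷ L′) (k ℕ.∸ suc j)) + binomial k j * dd (s ∷ L′) (k ℕ.∸ j))
        ≡⟨ identity₀ s (binomial k (suc j)) _ _ _ ⟩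
      binomial k (suc j) * (dd L′ (k ℕ.∸ suc j) + s * dd (s ∷ L′) (k ℕ.∸ suc j)) + binomial k j * dd (s ∷ L′) (k ℕ.∸ j)
        ≡⟨ cong (_+ binomial k j * dd (s ∷ L′) (k ℕ.∸ j)) lower ⟩
      binomial k (suc j) * dd (s ∷ L′) (k ℕ.∸ j) + binomial k j * dd (s ∷ L′) (k ℕ.∸ j)
        ≡⟨ identity₁ (binomial k (suc j)) (binomial k j) _ ⟩
      (binomial k j + binomial k (suc j)) * dd (s ∷ L′) (k ℕ.∸ j)
        ≡⟨ cong (_* dd (s ∷ L′) (k ℕ.∸ j)) (sym (binomial-pascal k j)) ⟩
      binomial (suc k) (suc j) * dd (s ∷ L′) (k ℕ.∸ j) ∎
      where
      open ≡-Reasoning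
      s : ℤ
      s = b + a
      L′ : List ℤ
      L′ = map (_+_ b) L
      identity₀ : ∀ s c x y z → c * x + (s * (c * y) + z) ≡ c * (x + s * y) + z
      identity₀ = solve-∀
      identity₁ : ∀ c d x → c * x + d * x ≡ (d + c) * x
      identity₁ = solve-∀
      lower : binomial k (suc j) * (dd L′ (k ℕ.∸ suc j) + s * dd (s ∷ L′) (k ℕ.∸ suc j))
            ≡ binomial k (suc j) * dd (s ∷ L′) (k ℕ.∸ j)
      -- For j ≥ k the truncated exponents do not fit the recursion for `dd`, but the binomial
      -- coefficient in front is then zero.
      lower with suc j ℕ.≤? k
      ... | yes j<k = cong (λ i → binomial k (suc j) * dd (s ∷ L′) i) (sym (ℕ.+-∸-assoc 1 j<k))
      ... | no  j≮k rewrite k>n⇒nCk≡0 (ℕ.≰⇒> j≮k) = refl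

    ddᵖ-Deg : ∀ {N} L k → suc (suc k) ℕ.≤ N ℕ.+ length L → Deg N (ddᵖ L k)
    ddᵖ-Deg []          k       _ = zeroᵈ λ _ _ → ≈-refl
    ddᵖ-Deg (a ∷ _ ∷ _) zero    _ = zeroᵈ λ where
      b zero    → ≈-refl
      b (suc j) → ≈-refl
    ddᵖ-Deg {zero}  (a ∷ [])    zero    (s≤s ())
    ddᵖ-Deg {suc N} (a ∷ [])    zero    _ = Deg-mono (s≤s z≤n) (const-Deg (+ 1))
    ddᵖ-Deg {N} (a ∷ L) (suc k) l = Deg-⊕
      (ddᵖ-Deg L k (ℕ.s≤s⁻¹ (subst (suc (suc (suc k)) ℕ.≤_) (ℕ.+-suc N (length L)) l)))
      (lin-part N l)
      where
      lin-part : ∀ N → suc (suc (suc k)) ℕ.≤ N ℕ.+ length (a ∷ L) → Deg N (λ b → lin (b + a) (ddᵖ (a ∷ L) k b))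
      lin-part zero    l = zeroᵈ λ b → lin-zero (b + a) (Deg-0 (ddᵖ-Deg {0} (a ∷ L) k (ℕ.≤-trans (ℕ.n≤1+n _) l)) b)
      lin-part (suc N) l = Deg-lin a (ddᵖ-Deg {N} (a ∷ L) k (ℕ.s≤s⁻¹ l))

    Residue : ℤ → Set
    Residue x = x ^ q ≈ + 1

    -- On residues, y^(q+k) and yᵏ agree, and so do their divided differences.
    dd-periodic : ∀ s L → Distinct (s ∷ L) → All Residue (s ∷ L) → ∀ k → dd (s ∷ L) (q ℕ.+ k) ≈ dd (s ∷ L) k
    dd-periodic s [] _ (r ∷ []) k = ≈-trans
      (≡⇒≈ (trans (dd-singleton s (q ℕ.+ k)) (ℤ.^-distribˡ-+-* s q k)))
      (≈-trans (*-cong r (≈-refl {s ^ k})) (≡⇒≈ (trans (ℤ.*-identityˡ _) (sym (dd-singleton s k)))))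
    dd-periodic s (s′ ∷ L) ((s≉s′ ∷ s∉L) ∷ s′∉L ∷ distinct) (r ∷ r′ ∷ rs) k =
      -- Both sides times s - s′ are differences of divided differences at one point fewer; distinct
      -- points allow the factor to be cancelled.
      cancel prime {s - s′} (λ e → s≉s′ (-≈0⇒≈ e))
        (≈-trans (≡⇒≈ (dd-recurrence s s′ L (q ℕ.+ k)))
        (≈-trans (combine₂ (+ 1) (- + 1) (dd-periodic s L (s∉L ∷ distinct) (r ∷ rs) k)
                                         (dd-periodic s′ L (s′∉L ∷ distinct) (r′ ∷ rs) k)
                                 (identity (dd (s ∷ L) (q ℕ.+ k)) (dd (s′ ∷ L) (q ℕ.+ k)) (dd (s ∷ L) k) (dd (s′ ∷ L) k)))
        (≡⇒≈ (sym (dd-recurrence s s′ L k)))))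
      where
      identity : ∀ x y x′ y′ → x - y - (x′ - y′) ≡ + 1 * (x - x′) + - + 1 * (y - y′)
      identity = solve-∀


    dd-periodic′ : ∀ L → Distinct L → All Residue L → ∀ k → dd L (q ℕ.+ k) ≈ dd L k
    dd-periodic′ []      _        _  k = ≈-refl
    dd-periodic′ (s ∷ L) distinct rs k = dd-periodic s L distinct rs k

    n<p⇒n≉0 : ∀ n → suc n ℕ.< p → + suc n ≉ + 0
    n<p⇒n≉0 n n<p e = ℕ.<⇒≱ n<p (ℕ.∣⇒≤ (≈0⇒∣ e))

    binomial≉0 : ∀ {n} → n ℕ.< p → ∀ k → k ℕ.≤ n → binomial n k ≉ + 0
    binomial≉0 n<p zero    _   = 1≉0
    binomial≉0 {n} n<p (suc k) k<n e = *-≉0 prime n-k≉0 (binomial≉0 n<p k (ℕ.<⇒≤ k<n))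
      (≈-trans (≡⇒≈ (sym (binomial-suc n k))) (*-zeroʳ (+ suc k) e))
      where
      n-k≉0 : + n - + k ≉ + 0
      n-k≉0 with ℕ.m≤n⇒∃[o]m+o≡n k<n
      ... | o , refl = λ z → n<p⇒n≉0 o (ℕ.≤-<-trans (ℕ.m≤n+m (suc o) k) (subst (ℕ._< p) (sym (ℕ.+-suc k o)) n<p))
                               (≈-trans (≡⇒≈ (identity (+ k) (+ o))) z)
        where
        identity : ∀ k o → + 1 + o ≡ + 1 + (k + o) - k
        identity = solve-∀

    Distinct-translate : ∀ b {L} → Distinct L → Distinct (map (_+_ b) L)
    Distinct-translate b = AllPairs.map⁺ ∘ AllPairs.map λ {x} {y} x≉y e → x≉y (combine₁ (+ 1) e (identity b x y))
      where
      identity : ∀ b x y → x - y ≡ + 1 * (b + x - (b + y))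
      identity = solve-∀

    -- Differences rather than sums, because the roots of ∏ C are the negatives of the elements of C.
    DifferencesAreResidues : List ℤ → List ℤ → Set
    DifferencesAreResidues A C = All (λ c → All (λ a → Residue (- c + a)) A) C

    module Auxiliary (A : List ℤ) (m : ℕ) (|A|≡1+m : length A ≡ suc m) (C : List ℤ)
                     (distinctA : Distinct A) (distinctC : Distinct C)
                     (residues : DifferencesAreResidues A C) where

      E : ℕ
      E = q ℕ.+ m

      F : Poly
      F b = ddᵖ A E b ⊕ const (- + 1)

      F-Deg : Deg (suc q) F
      F-Deg = Deg-⊕ (ddᵖ-Deg A E (ℕ.≤-reflexive (sym (trans (cong (suc q ℕ.+_) |A|≡1+m) (ℕ.+-suc (suc q) m)))))
                    (Deg-mono (s≤s z≤n) (const-Deg (- + 1)))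

      dd-residues : ∀ b → All (λ a → Residue (b + a)) A → ∀ k → dd (map (_+_ b) A) (q ℕ.+ k) ≈ dd (map (_+_ b) A) k
      dd-residues b rs = dd-periodic′ (map (_+_ b) A) (Distinct-translate b distinctA) (All.map⁺ rs)

      length-translate : ∀ b → length (map (_+_ b) A) ≡ suc m
      length-translate b = trans (List.length-map (_+_ b) A) |A|≡1+m

      -- The coefficient of tʲ is a binomial times the divided difference of y^(q+m-j), which on
      -- residues equals that of y^(m-j). At m + 1 points this is 1 for j = 0, cancelled by the
      -- constant -1, and 0 for 0 < j ≤ m.
      F-order : ∀ {b} → All (λ a → Residue (b + a)) A → ∀ j → j ℕ.< suc m → F b j ≈ + 0
      F-order {b} rs zero _ = +-cong {y = - + 1} (≈-trans (≡⇒≈ (ddᵖ-coefficient A E b 0)) (≈-trans (≡⇒≈ (ℤ.*-identityˡ _))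
        (≈-trans (dd-residues b rs m) (≡⇒≈ (dd-leading (map (_+_ b) A) m (sym (length-translate b))))))) ≈-refl
      F-order {b} rs (suc j) (s≤s j<m) = ≈-trans (≡⇒≈ (ℤ.+-identityʳ _))
        (≈-trans (≡⇒≈ (ddᵖ-coefficient A E b (suc j))) (*-zeroʳ (binomial E (suc j))
        (≈-trans (≡⇒≈ (cong (dd (map (_+_ b) A)) (ℕ.+-∸-assoc q j<m)))
        (≈-trans (dd-residues b rs (m ℕ.∸ suc j))
        (≡⇒≈ (dd-low (map (_+_ b) A) (m ℕ.∸ suc j) (subst (suc (m ℕ.∸ suc j) ℕ.<_) (sym (length-translate b)) (s≤s (m∸j<m j<m)))))))))
        where
        m∸j<m : ∀ {j m} → j ℕ.< m → m ℕ.∸ suc j ℕ.< m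
        m∸j<m {j} {suc m} _ = s≤s (ℕ.m∸n≤m m j)

      F-factored : ∃ λ h → Deg (suc q ℕ.∸ suc m ℕ.* length C) h × (∀ b j → F b j ≈ ∏^ (suc m) C h b j)
      F-factored = factor-power (suc m) F-Deg distinctC (All.map F-order residues)

      -- At 0 the coefficient of order q is the binomial of E over q times the divided difference of
      -- yᵐ, which is 1; E < p keeps the binomial prime to p, and 1 ≤ q keeps the constant -1 out of
      -- this coefficient.
      F≢0 : E ℕ.< p → 1 ℕ.≤ q → F (+ 0) q ≉ + 0
      F≢0 E<p 1≤q e = binomial≉0 E<p q (ℕ.m≤m+n q m) (≈-trans (≡⇒≈ (sym (leading q refl 1≤q))) e)
        where
        leading : ∀ i → i ≡ q → 1 ℕ.≤ i → F (+ 0) i ≡ binomial E i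
        leading (suc i) i≡q _ = begin
          ddᵖ A E (+ 0) (suc i) + + 0                     ≡⟨ ℤ.+-identityʳ _ ⟩
          ddᵖ A E (+ 0) (suc i)                           ≡⟨ ddᵖ-coefficient A E (+ 0) (suc i) ⟩
          binomial E (suc i) * dd (map (_+_ (+ 0)) A) (E ℕ.∸ suc i)         ≡⟨ cong (λ x → binomial E (suc i) * dd (map (_+_ (+ 0)) A) (E ℕ.∸ x)) i≡q ⟩
          binomial E (suc i) * dd (map (_+_ (+ 0)) A) (E ℕ.∸ q)             ≡⟨ cong (λ x → binomial E (suc i) * dd (map (_+_ (+ 0)) A) x) (ℕ.m+n∸m≡n q m) ⟩
          binomial E (suc i) * dd (map (_+_ (+ 0)) A) m   ≡⟨ cong (binomial E (suc i) *_) (dd-leading (map (_+_ (+ 0)) A) m (sym (length-translate (+ 0)))) ⟩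
          binomial E (suc i) * + 1                        ≡⟨ ℤ.*-identityʳ _ ⟩
          binomial E (suc i)                              ∎
          where open ≡-Reasoning

      ∏^-zero : ∀ k {h} → (∀ b j → h b j ≈ + 0) → ∀ b j → ∏^ k C h b j ≈ + 0
      ∏^-zero zero    z b j = z b j
      ∏^-zero (suc k) z b j = ⊛-vanish (∏ C b) j λ i _ → ∏^-zero k z b i

      -- Too many roots of order |A| would leave a quotient with `Deg 0`, hence F = 0. Besides its
      -- role in |A| |C| = q, this bounds the number of residues (`roots-bound`) and makes C maximal
      -- (`position`).
      bound : E ℕ.< p → 1 ℕ.≤ q → suc m ℕ.* length C ℕ.≤ q
      bound E<p 1≤q = ℕ.≮⇒≥ λ q<mn → F≢0 E<p 1≤q (vanish q<mn F-factored)
        where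
        vanish : q ℕ.< suc m ℕ.* length C → (∃ λ h → Deg (suc q ℕ.∸ suc m ℕ.* length C) h ×
                 (∀ b j → F b j ≈ ∏^ (suc m) C h b j)) → F (+ 0) q ≈ + 0
        vanish q<mn (h , dh , eq) = ≈-trans (eq (+ 0) q)
          (∏^-zero (suc m) (Deg-0 (subst (λ N → Deg N h) (ℕ.m≤n⇒m∸n≡0 q<mn) dh)) (+ 0) q)

  -- Algebraic elimination among Taylor coefficients

  module Elimination (p : ℕ) (prime : Prime p) where

    open Congruence p

    -- For φ(b + t) = φ₀ + φ₁ t + φ₂ t² + ⋯ and g(b + t) = u₀ t + u₁ t² + u₂ t³ + ⋯, these are the first two
    -- coefficients of M (M + 1) φ g″ + 3 φ′ g′ at b.
    ode₀ : (M φ₀ φ₁ u₀ u₁ : ℤ) → ℤ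
    ode₀ M φ₀ φ₁ u₀ u₁ = + 2 * (M * (M + + 1)) * φ₀ * u₁ + + 3 * φ₁ * u₀

    ode₁ : (M φ₀ φ₁ φ₂ u₀ u₁ u₂ : ℤ) → ℤ
    ode₁ M φ₀ φ₁ φ₂ u₀ u₁ u₂ =
      M * (M + + 1) * (+ 6 * φ₀ * u₂ + + 2 * φ₁ * u₁) + + 6 * (φ₁ * u₁ + φ₂ * u₀)

    β : ℤ → ℤ
    β M = + 3 * (M - + 1) * (M - + 2) * (+ 4 * M + + 3)

    -- The result of eliminating u₁, u₂, V₁ and V₂ from the relations in second-order below.
    obstruction : (M φ₀ φ₁ φ₂ K : ℤ) → ℤ
    obstruction M φ₀ φ₁ φ₂ K = β M * (φ₁ * φ₁) +
      φ₀ * (+ 4 * (M * (M + + 1)) * (M + + 2) * K - + 6 * (M * (M + + 1)) * (+ 4 * M - + 7) * φ₂)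

    infixr 5 _,+_
    _,+_ : ∀ {x y} → x ≈ + 0 → y ≈ + 0 → x + y ≈ + 0
    _,+_ = +-zero

    -- V₀ and V₁ will be the coefficients of F of orders |A| and |A| + 1, B₀ and B₁ their binomials,
    -- μ₀ and μ₁ the divided differences of y^(q-1) and y^(q-2). The 3 arises from the binomial
    -- ratio (q - 1) / (M + 1), because 2 (q - 1) = -3 modulo p.
    first-ratio : ∀ M q φ₀ φ₁ B₀ B₁ μ₀ μ₁ V₀ V₁ →
      V₀ - B₀ * μ₀ ≈ + 0 → V₁ - B₁ * μ₁ ≈ + 0 → (M + + 1) * B₁ - (q - + 1) * B₀ ≈ + 0 →
      φ₀ * μ₁ - φ₁ * μ₀ ≈ + 0 → + 2 * q + + 1 ≈ + 0 →
      + 2 * (M + + 1) * φ₀ * V₁ + + 3 * φ₁ * V₀ ≈ + 0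
    first-ratio M q φ₀ φ₁ B₀ B₁ μ₀ μ₁ V₀ V₁ e₀ e₁ eB eφ eq = ≈-trans (≡⇒≈ (identity M q φ₀ φ₁ B₀ B₁ μ₀ μ₁ V₀ V₁))
      (*-zeroʳ (+ 2 * (M + + 1) * φ₀) e₁ ,+ *-zeroʳ (+ 3 * φ₁) e₀ ,+ *-zeroʳ (+ 2 * φ₀ * μ₁) eB ,+
       *-zeroʳ (+ 2 * (q - + 1) * B₀) eφ ,+ *-zeroʳ (B₀ * φ₁ * μ₀) eq)
      where
      identity : ∀ M q φ₀ φ₁ B₀ B₁ μ₀ μ₁ V₀ V₁ →
        + 2 * (M + + 1) * φ₀ * V₁ + + 3 * φ₁ * V₀
        ≡ + 2 * (M + + 1) * φ₀ * (V₁ - B₁ * μ₁) + (+ 3 * φ₁ * (V₀ - B₀ * μ₀) +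
          (+ 2 * φ₀ * μ₁ * ((M + + 1) * B₁ - (q - + 1) * B₀) + (+ 2 * (q - + 1) * B₀ * (φ₀ * μ₁ - φ₁ * μ₀) +
           B₀ * φ₁ * μ₀ * (+ 2 * q + + 1))))
      identity = solve-∀

    -- One order further the binomial ratio is (q - 2) / (M + 2), and 2 (q - 2) = -5 accounts for
    -- the 5.
    second-ratio : ∀ M q φ₀ φ₁ φ₂ B₀ B₁ B₂ μ₀ μ₁ μ₂ V₀ V₁ V₂ →
      V₀ - B₀ * μ₀ ≈ + 0 → V₁ - B₁ * μ₁ ≈ + 0 → V₂ - B₂ * μ₂ ≈ + 0 →
      (M + + 1) * B₁ - (q - + 1) * B₀ ≈ + 0 → (M + + 2) * B₂ - (q - + 2) * B₁ ≈ + 0 →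
      φ₀ * μ₂ - φ₁ * μ₁ + φ₂ * μ₀ ≈ + 0 → + 2 * q + + 1 ≈ + 0 →
      + 4 * (M + + 1) * (M + + 2) * φ₀ * V₂ + + 5 * (+ 2 * (M + + 1) * φ₁ * V₁ + + 3 * φ₂ * V₀) ≈ + 0
    second-ratio M q φ₀ φ₁ φ₂ B₀ B₁ B₂ μ₀ μ₁ μ₂ V₀ V₁ V₂ e₀ e₁ e₂ eB eB′ eφ eq =
      ≈-trans (≡⇒≈ (trans (identity₁ M q φ₀ φ₁ φ₂ B₀ B₁ B₂ μ₀ μ₁ μ₂ V₀ V₁ V₂)
                          (cong (λ x → + 4 * (M + + 1) * (M + + 2) * φ₀ * (V₂ - B₂ * μ₂) +
                                  (+ 10 * (M + + 1) * φ₁ * (V₁ - B₁ * μ₁) + (+ 15 * φ₂ * (V₀ - B₀ * μ₀) + x)))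
                                (identity₂ M q φ₀ φ₁ φ₂ B₀ B₁ B₂ μ₀ μ₁ μ₂))))
      (*-zeroʳ (+ 4 * (M + + 1) * (M + + 2) * φ₀) e₂ ,+ *-zeroʳ (+ 10 * (M + + 1) * φ₁) e₁ ,+ *-zeroʳ (+ 15 * φ₂) e₀ ,+
       *-zeroʳ (+ 4 * (M + + 1) * φ₀ * μ₂) eB′ ,+ *-zeroʳ (+ 4 * (M + + 1) * (q - + 2) * B₁) eφ ,+
       *-zeroʳ (- + 4 * (q - + 2) * φ₂ * μ₀) eB ,+
       *-zeroʳ (+ 2 * (M + + 1) * B₁ * φ₁ * μ₁ - (+ 2 * q - + 7) * B₀ * φ₂ * μ₀) eq)
      where
      identity₁ : ∀ M q φ₀ φ₁ φ₂ B₀ B₁ B₂ μ₀ μ₁ μ₂ V₀ V₁ V₂ →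
        + 4 * (M + + 1) * (M + + 2) * φ₀ * V₂ + + 5 * (+ 2 * (M + + 1) * φ₁ * V₁ + + 3 * φ₂ * V₀)
        ≡ + 4 * (M + + 1) * (M + + 2) * φ₀ * (V₂ - B₂ * μ₂) +
          (+ 10 * (M + + 1) * φ₁ * (V₁ - B₁ * μ₁) + (+ 15 * φ₂ * (V₀ - B₀ * μ₀) +
          (+ 4 * (M + + 1) * (M + + 2) * φ₀ * (B₂ * μ₂) + + 10 * (M + + 1) * φ₁ * (B₁ * μ₁) + + 15 * φ₂ * (B₀ * μ₀))))
      identity₁ = solve-∀
      identity₂ : ∀ M q φ₀ φ₁ φ₂ B₀ B₁ B₂ μ₀ μ₁ μ₂ →
        + 4 * (M + + 1) * (M + + 2) * φ₀ * (B₂ * μ₂) + + 10 * (M + + 1) * φ₁ * (B₁ * μ₁) + + 15 * φ₂ * (B₀ * μ₀)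
        ≡ + 4 * (M + + 1) * φ₀ * μ₂ * ((M + + 2) * B₂ - (q - + 2) * B₁) +
          (+ 4 * (M + + 1) * (q - + 2) * B₁ * (φ₀ * μ₂ - φ₁ * μ₁ + φ₂ * μ₀) +
          (- + 4 * (q - + 2) * φ₂ * μ₀ * ((M + + 1) * B₁ - (q - + 1) * B₀) +
          (+ 2 * (M + + 1) * B₁ * φ₁ * μ₁ - (+ 2 * q - + 7) * B₀ * φ₂ * μ₀) * (+ 2 * q + + 1)))
      identity₂ = solve-∀

    first-order : ∀ M φ₀ φ₁ u₀ u₁ V₀ V₁ → V₀ ≉ + 0 →
      u₀ * V₁ - M * u₁ * V₀ ≈ + 0 → + 2 * (M + + 1) * φ₀ * V₁ + + 3 * φ₁ * V₀ ≈ + 0 →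
      ode₀ M φ₀ φ₁ u₀ u₁ ≈ + 0
    first-order M φ₀ φ₁ u₀ u₁ V₀ V₁ V₀≉0 eR eS = cancel-zero prime V₀≉0
      (≈-trans (≡⇒≈ (identity M φ₀ φ₁ u₀ u₁ V₀ V₁))
        (*-zeroʳ (- + 2 * (M + + 1) * φ₀) eR ,+ *-zeroʳ u₀ eS))
      where
      identity : ∀ M φ₀ φ₁ u₀ u₁ V₀ V₁ →
        V₀ * (+ 2 * (M * (M + + 1)) * φ₀ * u₁ + + 3 * φ₁ * u₀)
        ≡ - + 2 * (M + + 1) * φ₀ * (u₀ * V₁ - M * u₁ * V₀) + u₀ * (+ 2 * (M + + 1) * φ₀ * V₁ + + 3 * φ₁ * V₀)
      identity = solve-∀

    -- The multipliers of the five relations are chosen in turn: the first two cancel u₂ between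
    -- them, the third V₂, the fourth V₁ and the last u₁. What remains is divisible by u₀ V₀.
    second-order : ∀ M φ₀ φ₁ φ₂ u₀ u₁ u₂ V₀ V₁ V₂ K → u₀ ≉ + 0 → V₀ ≉ + 0 →
      + 2 * u₀ * V₂ - ((M - + 1) * u₁ * V₁ + + 2 * M * u₂ * V₀) ≈ + 0 →
      + 2 * (M + + 1) * φ₀ * V₁ + + 3 * φ₁ * V₀ ≈ + 0 →
      + 4 * (M + + 1) * (M + + 2) * φ₀ * V₂ + + 5 * (+ 2 * (M + + 1) * φ₁ * V₁ + + 3 * φ₂ * V₀) ≈ + 0 →
      ode₀ M φ₀ φ₁ u₀ u₁ ≈ + 0 → ode₁ M φ₀ φ₁ φ₂ u₀ u₁ u₂ - u₀ * K ≈ + 0 → obstruction M φ₀ φ₁ φ₂ K ≈ + 0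
    second-order M φ₀ φ₁ φ₂ u₀ u₁ u₂ V₀ V₁ V₂ K u₀≉0 V₀≉0 eR eS₁ eS₂ eO eK =
      cancel-zero prime u₀≉0 (cancel-zero prime V₀≉0
        (≈-trans (≡⇒≈ (identity M φ₀ φ₁ φ₂ u₀ u₁ u₂ V₀ V₁ V₂ K))
          (*-zeroʳ (- + 4 * N * (M + + 2) * φ₀ * V₀) eK ,+
           *-zeroʳ (- + 12 * N * (M + + 1) * (M + + 2) * φ₀ * φ₀) eR ,+
           *-zeroʳ (+ 6 * N * φ₀ * u₀) eS₂ ,+
           *-zeroʳ (- + 30 * N * φ₁ * u₀ - + 6 * N * (M + + 2) * (M - + 1) * φ₀ * u₁) eS₁ ,+
           *-zeroʳ ((M + + 2) * (+ 9 * (M - + 1) + + 4 * N + + 12) * φ₁ * V₀) eO)))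
      where
      N : ℤ
      N = M * (M + + 1)
      identity : ∀ M φ₀ φ₁ φ₂ u₀ u₁ u₂ V₀ V₁ V₂ K →
        V₀ * (u₀ * (+ 3 * (M - + 1) * (M - + 2) * (+ 4 * M + + 3) * (φ₁ * φ₁) +
          φ₀ * (+ 4 * (M * (M + + 1)) * (M + + 2) * K - + 6 * (M * (M + + 1)) * (+ 4 * M - + 7) * φ₂)))
        ≡ - + 4 * (M * (M + + 1)) * (M + + 2) * φ₀ * V₀ *
            ((M * (M + + 1)) * (+ 6 * φ₀ * u₂ + + 2 * φ₁ * u₁) + + 6 * (φ₁ * u₁ + φ₂ * u₀) - u₀ * K) +
          (- + 12 * (M * (M + + 1)) * (M + + 1) * (M + + 2) * φ₀ * φ₀ *
            (+ 2 * u₀ * V₂ - ((M - + 1) * u₁ * V₁ + + 2 * M * u₂ * V₀)) +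
          (+ 6 * (M * (M + + 1)) * φ₀ * u₀ *
            (+ 4 * (M + + 1) * (M + + 2) * φ₀ * V₂ + + 5 * (+ 2 * (M + + 1) * φ₁ * V₁ + + 3 * φ₂ * V₀)) +
          ((- + 30 * (M * (M + + 1)) * φ₁ * u₀ - + 6 * (M * (M + + 1)) * (M + + 2) * (M - + 1) * φ₀ * u₁) *
            (+ 2 * (M + + 1) * φ₀ * V₁ + + 3 * φ₁ * V₀) +
          (M + + 2) * (+ 9 * (M - + 1) + + 4 * (M * (M + + 1)) + + 12) * φ₁ * V₀ *
            (+ 2 * (M * (M + + 1)) * φ₀ * u₁ + + 3 * φ₁ * u₀))))
      identity = solve-∀

  -- The inequality |C| ≤ 2 |A| - 2 when `β` is nonzero

  module Sharpening (p : ℕ) (prime : Prime p) (q : ℕ) where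

    open HansonPetridis p prime q public
    open Elimination p prime

    -- Applies to u the recurrence with characteristic polynomial ∏ (s - Y), s running over b + L.
    recurrence : ℤ → List ℤ → Series → ℤ
    recurrence b []      u = u 0
    recurrence b (a ∷ L) u = recurrence b L (λ k → (b + a) * u k - u (suc k))

    recurrence-cong : ∀ b L {u v} → (∀ k → u k ≡ v k) → recurrence b L u ≡ recurrence b L v
    recurrence-cong b []      e = e 0
    recurrence-cong b (a ∷ L) e = recurrence-cong b L λ k → cong₂ (λ x y → (b + a) * x - y) (e k) (e (suc k))

    -- As s · `dd (s ∷ L) k` - `dd (s ∷ L) (suc k)` = - `dd L k`, each factor s - Y removes one
    -- point, until none is left. The scalar `e` absorbs the signs.
    recurrence-dd : ∀ b L e i → recurrence b L (λ k → e * dd (map (_+_ b) L) (k ℕ.+ i)) ≡ + 0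
    recurrence-dd b []      e i = ℤ.*-zeroʳ e
    recurrence-dd b (a ∷ L) e i = trans
      (recurrence-cong b L λ k → identity (b + a) e (dd (map (_+_ b) L) (k ℕ.+ i)) (dd (map (_+_ b) (a ∷ L)) (k ℕ.+ i)))
      (recurrence-dd b L (- e) i)
      where
      identity : ∀ s e x y → s * (e * y) - e * (x + s * y) ≡ - e * x
      identity = solve-∀

    -- The coefficient of Yʲ in ∏ (s - Y) is (-1)ʲ times that of tʲ in ∏ L at b, and only j ≤ 2
    -- meets nonzero terms.
    recurrence-low : ∀ b L u → (∀ j → 3 ℕ.+ j ℕ.≤ length L → u (3 ℕ.+ j) ≈ + 0) →
      recurrence b L u ≈ ∏ L b 0 * u 0 - ∏ L b 1 * u 1 + ∏ L b 2 * u 2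
    recurrence-low b [] u _ = ≡⇒≈ (identity (u 0) (u 1) (u 2))
      where
      identity : ∀ x y z → x ≡ + 1 * x - + 0 * y + + 0 * z
      identity = solve-∀
    recurrence-low b (a ∷ []) u _ = ≡⇒≈ (identity (b + a) (u 0) (u 1) (u 2))
      where
      identity : ∀ s x y z → s * x - y ≡ s * + 1 * x - (s * + 0 + + 1) * y + (s * + 0 + + 0) * z
      identity = solve-∀
    recurrence-low b (a ∷ a′ ∷ []) u _ = ≡⇒≈ (identity (b + a) (b + a′) (u 0) (u 1) (u 2))
      where
      identity : ∀ s t x y z → t * (s * x - y) - (s * y - z)
        ≡ s * (t * + 1) * x - (s * (t * + 0 + + 1) + t * + 1) * y + (s * (t * + 0 + + 0) + (t * + 0 + + 1)) * z
      identity = solve-∀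
    recurrence-low b (a ∷ L@(_ ∷ _ ∷ _)) u low = ≈-trans
      (recurrence-low b L _ λ j 3+j≤l → ≈-trans
        (+-cong (*-zeroʳ (b + a) (low j (ℕ.m≤n⇒m≤1+n 3+j≤l))) (-‿zero (low (suc j) (s≤s 3+j≤l)))) ≈-refl)
      (combine₁ (- ∏ L b 2) (low 0 (s≤s (s≤s (s≤s z≤n))))
        (identity (b + a) (∏ L b 0) (∏ L b 1) (∏ L b 2) (u 0) (u 1) (u 2) (u 3)))
      where
      -‿zero : ∀ {x} → x ≈ + 0 → - x ≈ + 0
      -‿zero {x} e = combine₁ (- + 1) e (negate x)
        where
        negate : ∀ x → - x - + 0 ≡ - + 1 * (x - + 0)
        negate = solve-∀
      identity : ∀ s f₀ f₁ f₂ x y z w →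
        f₀ * (s * x - y) - f₁ * (s * y - z) + f₂ * (s * z - w)
          - (s * f₀ * x - (s * f₁ + f₀) * y + (s * f₂ + f₁) * z)
        ≡ - f₂ * (w - + 0)
      identity = solve-∀

    recurrence-dd-low : ∀ b L i → (∀ j → 3 ℕ.+ j ℕ.≤ length L → dd (map (_+_ b) L) (3 ℕ.+ j ℕ.+ i) ≈ + 0) →
      ∏ L b 0 * dd (map (_+_ b) L) i - ∏ L b 1 * dd (map (_+_ b) L) (suc i)
        + ∏ L b 2 * dd (map (_+_ b) L) (suc (suc i)) ≈ + 0
    recurrence-dd-low b L i low = ≈-trans (≈-sym (recurrence-low b L (λ k → dd (map (_+_ b) L) (k ℕ.+ i)) low))
      (≡⇒≈ (trans (recurrence-cong b L λ k → sym (ℤ.*-identityˡ _)) (recurrence-dd b L (+ 1) i)))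

    module Local (A : List ℤ) (m : ℕ) (|A|≡1+m : length A ≡ suc m) (C : List ℤ)
                 (distinctA : Distinct A) (distinctC : Distinct C)
                 (residues : DifferencesAreResidues A C)
                 (|A||C|≡q : suc m ℕ.* length C ≡ q) (E<p : q ℕ.+ m ℕ.< p)
                 (p≡1+2q : p ≡ suc (2 ℕ.* q))
                 (1≤m : 1 ℕ.≤ m) (r : ℕ) (q≡3+r : q ≡ 3 ℕ.+ r) (M : ℤ) (M≡1+m : M ≡ + suc m) where

      open Auxiliary A m |A|≡1+m C distinctA distinctC residues

      1≤q : 1 ℕ.≤ q
      1≤q = subst (1 ℕ.≤_) (sym q≡3+r) (s≤s z≤n)

      N : ℤ
      N = M * (M + + 1)

      2q+1≈0 : + 2 * + q + + 1 ≈ + 0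
      2q+1≈0 = ≈-trans (≡⇒≈ (trans (cong (_+ + 1) (sym (ℤ.pos-* 2 q))) (trans (ℤ.+-comm (+ (2 ℕ.* q)) (+ 1)) (cong +_ (sym p≡1+2q)))))
                       (∣⇒≈0 ℕ.∣-refl)

      binomial-step : ∀ s → (M + + suc s) * binomial E (suc m ℕ.+ suc s) - (+ q - + suc s) * binomial E (suc m ℕ.+ s) ≈ + 0
      binomial-step s = ≈⇒-≈0 (≡⇒≈ (begin
        (M + + suc s) * binomial E (suc m ℕ.+ suc s)
          ≡⟨ cong (λ x → (x + + suc s) * binomial E (suc m ℕ.+ suc s)) M≡1+m ⟩
        + (suc m ℕ.+ suc s) * binomial E (suc m ℕ.+ suc s)
          ≡⟨ cong (λ k → + k * binomial E k) (ℕ.+-suc (suc m) s) ⟩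
        + suc (suc m ℕ.+ s) * binomial E (suc (suc m ℕ.+ s))
          ≡⟨ binomial-suc E (suc m ℕ.+ s) ⟩
        (+ E - + (suc m ℕ.+ s)) * binomial E (suc m ℕ.+ s)
          ≡⟨ cong (_* binomial E (suc m ℕ.+ s)) (identity (+ q) (+ m) (+ s)) ⟩
        (+ q - + suc s) * binomial E (suc m ℕ.+ s) ∎))
        where
        open ≡-Reasoning
        identity : ∀ q m s → q + m - (+ 1 + m + s) ≡ q - (+ 1 + s)
        identity = solve-∀

      module At (h : Poly) (h-Deg : Deg 1 h) (F-power : ∀ b j → F b j ≈ ∏^ (suc m) C h b j)
                (b : ℤ) (rs : All (λ a → Residue (b + a)) A) (root : SimpleRoot (∏ C b)) where

        S : List ℤ
        S = map (_+_ b) A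

        φ u V : Series
        φ = ∏ A b
        u = tail (∏ C b)
        V = (u ^⊛ suc m) (h b)

        h-const : ∃ λ c → ∀ b j → h b j ≈ const c j
        h-const = Deg-1 h-Deg

        h≉0 : h b 0 ≉ + 0
        h≉0 e = F≢0 E<p 1≤q (≈-trans (F-power (+ 0) q) (∏^-zero (suc m) h≈0 (+ 0) q))
          where
          h≈0 : ∀ b′ j → h b′ j ≈ + 0
          h≈0 b′ zero    = ≈-trans (proj₂ h-const b′ 0) (≈-trans (≈-sym (proj₂ h-const b 0)) e)
          h≈0 b′ (suc j) = proj₂ h-const b′ (suc j)

        open PowerCoefficients u (h b) (proj₂ h-const b 1) (proj₂ h-const b 2)

        u₀≉0 : u 0 ≉ + 0
        u₀≉0 = proj₂ root

        V₀≉0 : V 0 ≉ + 0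
        V₀≉0 = leading≉0 (suc m) u₀≉0 h≉0

        F-V : ∀ s → F b (suc m ℕ.+ s) ≈ V s
        F-V s = ≈-trans (F-power b (suc m ℕ.+ s))
          (≈-trans (∏^-expansion (suc m) C h b (proj₁ root) (suc m ℕ.+ s)) (≡⇒≈ (shift^-+ (suc m) V s)))

        -- From order |A| on, the exponent E - (|A| + s) = q - 1 - s is below q: periodicity no
        -- longer reduces it, and the divided difference stays as an unknown.
        V-dd : ∀ s → V s - binomial E (suc m ℕ.+ s) * dd S (q ℕ.∸ suc s) ≈ + 0
        V-dd s = ≈⇒-≈0 (≈-trans (≈-sym (F-V s)) (≡⇒≈ (begin
          ddᵖ A E b (suc m ℕ.+ s) + + 0             ≡⟨ ℤ.+-identityʳ _ ⟩
          ddᵖ A E b (suc m ℕ.+ s)                   ≡⟨ ddᵖ-coefficient A E b (suc m ℕ.+ s) ⟩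
          binomial E (suc m ℕ.+ s) * dd S (E ℕ.∸ (suc m ℕ.+ s))
            ≡⟨ cong (λ k → binomial E (suc m ℕ.+ s) * dd S k) (begin
                 q ℕ.+ m ℕ.∸ (suc m ℕ.+ s)  ≡⟨ cong₂ ℕ._∸_ (ℕ.+-comm q m) (sym (ℕ.+-suc m s)) ⟩
                 m ℕ.+ q ℕ.∸ (m ℕ.+ suc s)  ≡⟨ ℕ.[m+n]∸[m+o]≡n∸o m q (suc s) ⟩
                 q ℕ.∸ suc s                ∎) ⟩
          binomial E (suc m ℕ.+ s) * dd S (q ℕ.∸ suc s) ∎)))
          where open ≡-Reasoning

        V-at : ∀ s {k} → q ≡ suc s ℕ.+ k → V s - binomial E (suc m ℕ.+ s) * dd S k ≈ + 0
        V-at s {k} q≡ = subst (λ i → V s - binomial E (suc m ℕ.+ s) * dd S i ≈ + 0)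
          (trans (cong (ℕ._∸ suc s) q≡) (ℕ.m+n∸m≡n (suc s) k)) (V-dd s)

        dd-beyond : ∀ j {k} → k ≡ q ℕ.+ j → suc j ℕ.< length A → dd S k ≈ + 0
        dd-beyond j refl l = ≈-trans (dd-residues b rs j)
          (≡⇒≈ (dd-low S j (subst (suc j ℕ.<_) (sym (List.length-map (_+_ b) A)) l)))

        -- The recurrence is started at exponent q - 2. By periodicity its terms from exponent q on
        -- equal the initial zeros of the sequence, so only q - 2 and q - 1 survive. Starting at q -
        -- 3 gives `φ-second`.
        φ-first : φ 0 * dd S (suc r) - φ 1 * dd S (suc (suc r)) ≈ + 0
        φ-first = combine₂ (+ 1) (- φ 2)
          (recurrence-dd-low b A (suc r) λ j l → dd-beyond (suc j) (shifted j) l)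
          (dd-beyond 0 {3 ℕ.+ r} (trans (sym q≡3+r) (sym (ℕ.+-identityʳ q)))
            (subst (1 ℕ.<_) (sym |A|≡1+m) (s≤s 1≤m)))
          (identity (φ 0) (φ 1) (φ 2) (dd S (suc r)) (dd S (suc (suc r))) (dd S (suc (suc (suc r)))))
          where
          shifted : ∀ j → 3 ℕ.+ j ℕ.+ suc r ≡ q ℕ.+ suc j
          shifted j = trans (rearrange j r) (cong (ℕ._+ suc j) (sym q≡3+r))
            where
            rearrange : ∀ j r → 3 ℕ.+ j ℕ.+ suc r ≡ 3 ℕ.+ r ℕ.+ suc j
            rearrange = ℕ-Solver.solve-∀
          identity : ∀ f₀ f₁ f₂ x y z → f₀ * x - f₁ * y - + 0 ≡ + 1 * (f₀ * x - f₁ * y + f₂ * z - + 0) + - f₂ * (z - + 0)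
          identity = solve-∀

        φ-second : φ 0 * dd S r - φ 1 * dd S (suc r) + φ 2 * dd S (suc (suc r)) ≈ + 0
        φ-second = recurrence-dd-low b A r λ j l → dd-beyond j (shifted j) (ℕ.≤-trans (ℕ.n≤1+n _) l)
          where
          shifted : ∀ j → 3 ℕ.+ j ℕ.+ r ≡ q ℕ.+ j
          shifted j = trans (rearrange j r) (cong (ℕ._+ j) (sym q≡3+r))
            where
            rearrange : ∀ j r → 3 ℕ.+ j ℕ.+ r ≡ 3 ℕ.+ r ℕ.+ j
            rearrange = ℕ-Solver.solve-∀

        V-first : + 2 * (M + + 1) * φ 0 * V 1 + + 3 * φ 1 * V 0 ≈ + 0
        V-first = first-ratio M (+ q) (φ 0) (φ 1) (binomial E (suc m ℕ.+ 0)) (binomial E (suc m ℕ.+ 1))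
          (dd S (suc (suc r))) (dd S (suc r)) (V 0) (V 1)
          (V-at 0 q≡3+r) (V-at 1 q≡3+r) (binomial-step 0) φ-first 2q+1≈0

        V-second : + 4 * (M + + 1) * (M + + 2) * φ 0 * V 2 + + 5 * (+ 2 * (M + + 1) * φ 1 * V 1 + + 3 * φ 2 * V 0) ≈ + 0
        V-second = second-ratio M (+ q) (φ 0) (φ 1) (φ 2)
          (binomial E (suc m ℕ.+ 0)) (binomial E (suc m ℕ.+ 1)) (binomial E (suc m ℕ.+ 2))
          (dd S (suc (suc r))) (dd S (suc r)) (dd S r) (V 0) (V 1) (V 2)
          (V-at 0 q≡3+r) (V-at 1 q≡3+r) (V-at 2 q≡3+r) (binomial-step 0) (binomial-step 1) φ-second 2q+1≈0

        V-power₁ : u 0 * V 1 - M * u 1 * V 0 ≈ + 0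
        V-power₁ = subst (λ x → u 0 * V 1 - x * u 1 * V 0 ≈ + 0) (sym M≡1+m) (≈⇒-≈0 (first (suc m)))

        V-power₂ : + 2 * u 0 * V 2 - ((M - + 1) * u 1 * V 1 + + 2 * M * u 2 * V 0) ≈ + 0
        V-power₂ = subst (λ x → + 2 * u 0 * V 2 - ((x - + 1) * u 1 * V 1 + + 2 * x * u 2 * V 0) ≈ + 0)
          (sym M≡1+m) (≈⇒-≈0 (second (suc m)))

        ode₀≈0 : ode₀ M (φ 0) (φ 1) (u 0) (u 1) ≈ + 0
        ode₀≈0 = first-order M (φ 0) (φ 1) (u 0) (u 1) (V 0) (V 1) V₀≉0 V-power₁ V-first

        obstruction≈0 : ∀ K → ode₁ M (φ 0) (φ 1) (φ 2) (u 0) (u 1) (u 2) - u 0 * K ≈ + 0 →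
                        obstruction M (φ 0) (φ 1) (φ 2) K ≈ + 0
        obstruction≈0 K = second-order M (φ 0) (φ 1) (φ 2) (u 0) (u 1) (u 2) (V 0) (V 1) (V 2) K
          u₀≉0 V₀≉0 V-power₂ V-first V-second ode₀≈0

      record LocalData (b : ℤ) : Set where
        constructor local
        field
          root        : SimpleRoot (∏ C b)
          firstOrder  : ode₀ M (∏ A b 0) (∏ A b 1) (∏ C b 1) (∏ C b 2) ≈ + 0
          secondOrder : ∀ K → ode₁ M (∏ A b 0) (∏ A b 1) (∏ A b 2) (∏ C b 1) (∏ C b 2) (∏ C b 3) - ∏ C b 1 * K ≈ + 0 →
                        obstruction M (∏ A b 0) (∏ A b 1) (∏ A b 2) K ≈ + 0
      open LocalData

      local-data : ∃ (λ h → Deg (suc q ℕ.∸ suc m ℕ.* length C) h × (∀ b j → F b j ≈ ∏^ (suc m) C h b j)) →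
                   All (LocalData ∘ -_) C
      local-data (h , h-Deg , F-power) = All.zipWith at (residues , ∏-simpleRoots distinctC)
        where
        h-Deg₁ : Deg 1 h
        h-Deg₁ = subst (λ N → Deg N h) (trans (cong (suc q ℕ.∸_) |A||C|≡q) (ℕ.m+n∸n≡m 1 q)) h-Deg
        at : ∀ {c} → All (λ a → Residue (- c + a)) A × SimpleRoot (∏ C (- c)) → LocalData (- c)
        at {c} (rs , root) = local root ode₀≈0 obstruction≈0
          where open At h h-Deg₁ F-power (- c) rs root

      Q : Poly
      Q b = N ⊙ (∏ A b ⊛ ∂ (∂ (∏ C)) b) ⊕ + 3 ⊙ (∂ (∏ A) b ⊛ ∂ (∏ C) b)

      ∂∏A-Deg : Deg (suc m) (∂ (∏ A))
      ∂∏A-Deg = subst (λ k → Deg k (∂ (∏ A))) |A|≡1+m (Deg-∂ (∏-Deg A))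

      Q-Deg : ∀ {n} → length C ≡ suc n → Deg (m ℕ.+ length C) Q
      Q-Deg {n} |C|≡ = Deg-⊕
        (Deg-⊙ N (subst (λ k → Deg k (λ b → ∏ A b ⊛ ∂ (∂ (∏ C)) b)) degree (Deg-⊛ (∏-Deg A) ∂∂∏C-Deg)))
        (Deg-⊙ (+ 3) (Deg-⊛ ∂∏A-Deg (Deg-∂ (∏-Deg C))))
        where
        ∂∂∏C-Deg : Deg n (∂ (∂ (∏ C)))
        ∂∂∏C-Deg = Deg-∂ (subst (λ k → Deg k (∂ (∏ C))) |C|≡ (Deg-∂ (∏-Deg C)))
        degree : length A ℕ.+ n ≡ m ℕ.+ length C
        degree = trans (cong (ℕ._+ n) |A|≡1+m) (trans (sym (ℕ.+-suc m n)) (cong (m ℕ.+_) (sym |C|≡)))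

      -- Takes the value `obstruction` at every point; since ∂∂ yields 2 φ₂, the 6 there becomes 3
      -- here.
      P : Poly → Poly
      P K b = β M ⊙ (∂ (∏ A) b ⊛ ∂ (∏ A) b)
            ⊕ ∏ A b ⊛ (+ 4 * N * (M + + 2) ⊙ K b ⊕ - + 3 * N * (+ 4 * M - + 7) ⊙ ∂ (∂ (∏ A)) b)

      P-Deg : ∀ {K} → Deg m K → Deg (suc m ℕ.+ m) (P K)
      P-Deg {K} d = Deg-⊕
        (Deg-⊙ (β M) (subst (λ k → Deg k (λ b → ∂ (∏ A) b ⊛ ∂ (∏ A) b)) (ℕ.+-suc m m) (Deg-⊛ ∂∏A-Deg ∂∏A-Deg)))
        (subst (λ k → Deg (k ℕ.+ m) (λ b → ∏ A b ⊛ (+ 4 * N * (M + + 2) ⊙ K b ⊕ - + 3 * N * (+ 4 * M - + 7) ⊙ ∂ (∂ (∏ A)) b))) |A|≡1+m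
          (Deg-⊛ (∏-Deg A) (Deg-⊕ (Deg-⊙ (+ 4 * N * (M + + 2)) d) (Deg-⊙ (- + 3 * N * (+ 4 * M - + 7)) (Deg-∂ ∂∏A-Deg)))))

      P-value : ∀ K b → P K b 0 ≡ obstruction M (∏ A b 0) (∏ A b 1) (∏ A b 2) (K b 0)
      P-value K b = identity (β M) M (∏ A b 0) (∏ A b 1) (∏ A b 2) (K b 0)
        where
        identity : ∀ β M x y z k →
          β * (+ 1 * y * (+ 1 * y)) +
            x * (+ 4 * (M * (M + + 1)) * (M + + 2) * k + - + 3 * (M * (M + + 1)) * (+ 4 * M - + 7) * (+ 1 * (+ 2 * z)))
          ≡ β * (y * y) + x * (+ 4 * (M * (M + + 1)) * (M + + 2) * k - + 6 * (M * (M + + 1)) * (+ 4 * M - + 7) * z)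
        identity = solve-∀

      -- At a root of ∏ A only the term with `β` survives, and the derivative of ∏ A is nonzero
      -- there because the root is simple.
      P≢0 : ∀ K → β M ≉ + 0 → ¬ (∀ b j → P K b j ≈ + 0)
      P≢0 K β≉0 z = at-root A distinctA |A|≡1+m (∏-simpleRoots distinctA)
        where
        at-root : ∀ L → Distinct L → length L ≡ suc m → All (λ a → SimpleRoot (∏ A (- a))) L → ⊥
        at-root []      _ () _
        at-root (a ∷ L) _ _  ((φ₀≈0 , φ₁≉0) ∷ _) = *-≉0 prime β≉0 (*-≉0 prime φ₁≉0 φ₁≉0)
          (combine₂ (+ 1) (- y) (≈-trans (≡⇒≈ (sym (P-value K (- a)))) (z (- a) 0)) φ₀≈0
            (identity (β M * (∏ A (- a) 1 * ∏ A (- a) 1)) (∏ A (- a) 0) y))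
          where
          y : ℤ
          y = + 4 * (M * (M + + 1)) * (M + + 2) * K (- a) 0 - + 6 * (M * (M + + 1)) * (+ 4 * M - + 7) * ∏ A (- a) 2
          identity : ∀ w x y → w - + 0 ≡ + 1 * (w + x * y - + 0) + - y * (x - + 0)
          identity = solve-∀

      Q-root : ∀ {c} → LocalData (- c) → Q (- c) 0 ≈ + 0
      Q-root {c} d = ≈-trans (≡⇒≈ (identity M (∏ A (- c) 0) (∏ A (- c) 1) (∏ C (- c) 1) (∏ C (- c) 2))) (firstOrder d)
        where
        identity : ∀ M x y u v → M * (M + + 1) * (x * (+ 1 * (+ 2 * v))) + + 3 * (+ 1 * y * (+ 1 * u))
                               ≡ + 2 * (M * (M + + 1)) * x * v + + 3 * y * u
        identity = solve-∀

      P-root : ∀ {K} → (∀ b j → Q b j ≈ (∏ C b ⊛ K b) j) → ∀ {c} → LocalData (- c) → P K (- c) 0 ≈ + 0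
      P-root {K} Q≈ {c} d = ≈-trans (≡⇒≈ (P-value K (- c)))
        -- The coefficient of t in Q = ∏ C · K is u₀ K(b) plus a multiple of ∏ C at b, which is zero
        -- at the root.
        (secondOrder d (K (- c) 0) (combine₂ (+ 1) (K (- c) 1) (Q≈ (- c) 1) (proj₁ (root d))
          (identity M (∏ A (- c) 0) (∏ A (- c) 1) (∏ A (- c) 2)
            (∏ C (- c) 0) (∏ C (- c) 1) (∏ C (- c) 2) (∏ C (- c) 3) (K (- c) 0) (K (- c) 1))))
        where
        identity : ∀ M x y z g u v w k k′ →
          M * (M + + 1) * (+ 6 * x * w + + 2 * y * v) + + 6 * (y * v + z * u) - u * k - + 0
          ≡ + 1 * (M * (M + + 1) * (x * (+ 2 * (+ 3 * w)) + y * (+ 1 * (+ 2 * v)))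
                   + + 3 * (+ 1 * y * (+ 2 * v) + + 2 * z * (+ 1 * u)) - (g * k′ + u * k))
            + k′ * (g - + 0)
        identity = solve-∀

      sharp : β M ≉ + 0 → ∀ {n} → length C ≡ suc n → length C ℕ.≤ m ℕ.+ m
      sharp β≉0 |C|≡ = ℕ.≮⇒≥ λ 2m<n → vanish 2m<n (factor (Q-Deg |C|≡) distinctC (All.map Q-root locals))
        where
        locals : All (LocalData ∘ -_) C
        locals = local-data F-factored
        vanish : m ℕ.+ m ℕ.< length C →
          ¬ (∃ λ K → Deg (m ℕ.+ length C ℕ.∸ length C) K × (∀ b j → Q b j ≈ (∏ C b ⊛ K b) j))
        vanish 2m<n (K , K-Deg , Q≈) = P≡0 (factor (P-Deg K-Degₘ) distinctC (All.map (P-root Q≈) locals))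
          where
          K-Degₘ : Deg m K
          K-Degₘ = subst (λ k → Deg k K) (ℕ.m+n∸n≡m m (length C)) K-Deg
          P≡0 : ¬ (∃ λ k → Deg (suc m ℕ.+ m ℕ.∸ length C) k × (∀ b j → P K b j ≈ (∏ C b ⊛ k b) j))
          P≡0 (k , k-Deg , P≈) = P≢0 K β≉0 λ b j → ≈-trans (P≈ b j) (⊛-vanish (∏ C b) j λ i _ →
            Deg-0 (subst (λ N → Deg N k) (ℕ.m≤n⇒m∸n≡0 2m<n) k-Deg) b i)

  -- Fermat's theorem, Euler's criterion and the counting of residues

  0^n≡0 : ∀ {n} → 1 ℕ.≤ n → (+ 0) ^ n ≡ + 0
  0^n≡0 {suc n} _ = refl

  module Residues (p : ℕ) (prime : Prime p) (q : ℕ) (p≡1+2q : p ≡ suc (2 ℕ.* q)) (1≤q : 1 ℕ.≤ q) where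

    open HansonPetridis p prime q public

    p≈0 : + p ≈ + 0
    p≈0 = ∣⇒≈0 ℕ.∣-refl

    1≤p : 1 ℕ.≤ p
    1≤p = subst (1 ℕ.≤_) (sym p≡1+2q) (s≤s z≤n)

    binomial≈0 : ∀ j → suc j ℕ.< p → binomial p (suc j) ≈ + 0
    binomial≈0 zero    _ = ≈-trans (≡⇒≈ (cong +_ (nC1≡n p))) p≈0
    binomial≈0 (suc j) l = cancel-zero prime (n<p⇒n≉0 (suc j) l)
      (≈-trans (≡⇒≈ (binomial-suc p (suc j))) (*-zeroʳ (+ p - + suc j) (binomial≈0 j (ℕ.<⇒≤ l))))

    -- The coefficients of (X + 1)ᵖ - Xᵖ - 1 vanish modulo p.
    frobenius : ∀ b → (b + + 1) ^ p - b ^ p - + 1 ≈ + 0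
    frobenius b = ≈-trans (≡⇒≈ (sym (value b))) (Deg-vanish f-Deg coefficients b 0)
      where
      f : Poly
      -- At a single point the divided difference is the power itself, so `ddᵖ (a ∷ []) p` is (X +
      -- a)ᵖ together with its degree bound.
      f b = ddᵖ (+ 1 ∷ []) p b ⊕ (- + 1 ⊙ ddᵖ (+ 0 ∷ []) p b ⊕ const (- + 1))
      f-Deg : Deg (suc p) f
      f-Deg = Deg-⊕ (ddᵖ-Deg (+ 1 ∷ []) p (ℕ.≤-reflexive (ℕ.+-comm 1 (suc p))))
        (Deg-⊕ (Deg-⊙ (- + 1) (ddᵖ-Deg (+ 0 ∷ []) p (ℕ.≤-reflexive (ℕ.+-comm 1 (suc p)))))
               (Deg-mono (s≤s z≤n) (const-Deg (- + 1))))
      ddᵖ-singleton : ∀ a b j → ddᵖ (a ∷ []) p b j ≡ binomial p j * (b + a) ^ (p ℕ.∸ j)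
      ddᵖ-singleton a b j = trans (ddᵖ-coefficient (a ∷ []) p b j) (cong (binomial p j *_) (dd-singleton (b + a) (p ℕ.∸ j)))
      value : ∀ b → f b 0 ≡ (b + + 1) ^ p - b ^ p - + 1
      value b = begin
        ddᵖ (+ 1 ∷ []) p b 0 + (- + 1 * ddᵖ (+ 0 ∷ []) p b 0 + - + 1)
          ≡⟨ cong₂ (λ x y → x + (- + 1 * y + - + 1)) (ddᵖ-singleton (+ 1) b 0) (ddᵖ-singleton (+ 0) b 0) ⟩
        + 1 * (b + + 1) ^ p + (- + 1 * (+ 1 * (b + + 0) ^ p) + - + 1)
          ≡⟨ cong (λ x → + 1 * (b + + 1) ^ p + (- + 1 * (+ 1 * x ^ p) + - + 1)) (ℤ.+-identityʳ b) ⟩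
        + 1 * (b + + 1) ^ p + (- + 1 * (+ 1 * b ^ p) + - + 1)
          ≡⟨ identity ((b + + 1) ^ p) (b ^ p) ⟩
        (b + + 1) ^ p - b ^ p - + 1 ∎
        where
        open ≡-Reasoning
        identity : ∀ x y → + 1 * x + (- + 1 * (+ 1 * y) + - + 1) ≡ x - y - + 1
        identity = solve-∀
      coefficients : ∀ j → f (+ 0) j ≈ + 0
      coefficients zero = ≡⇒≈ (trans (value (+ 0)) (cong₂ (λ x y → x - y - + 1) (ℤ.^-zeroˡ p) (0^n≡0 1≤p)))
      coefficients (suc j) = ≈-trans
        (≡⇒≈ (cong₂ (λ x y → x + (- + 1 * y + + 0)) (ddᵖ-singleton (+ 1) (+ 0) (suc j)) (ddᵖ-singleton (+ 0) (+ 0) (suc j))))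
        (higher (ℕ.<-cmp (suc j) p))
        where
        higher : _ → binomial p (suc j) * (+ 1) ^ (p ℕ.∸ suc j) + (- + 1 * (binomial p (suc j) * (+ 0) ^ (p ℕ.∸ suc j)) + + 0) ≈ + 0
        higher (tri< l _ _) = +-zero (*-zeroˡ ((+ 1) ^ (p ℕ.∸ suc j)) (binomial≈0 j l))
          (+-zero (*-zeroʳ (- + 1) (*-zeroˡ ((+ 0) ^ (p ℕ.∸ suc j)) (binomial≈0 j l))) ≈-refl)
        higher (tri≈ _ j≡p _) = ≡⇒≈ (trans
          (cong (λ i → binomial p (suc j) * (+ 1) ^ i + (- + 1 * (binomial p (suc j) * (+ 0) ^ i) + + 0))
                (trans (cong (ℕ._∸ suc j) (sym j≡p)) (ℕ.n∸n≡0 (suc j))))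
          (identity (binomial p (suc j))))
          where
          identity : ∀ c → c * + 1 + (- + 1 * (c * + 1) + + 0) ≡ + 0
          identity = solve-∀
        higher (tri> _ _ l) = ≡⇒≈ (trans
          (cong (λ c → + c * (+ 1) ^ (p ℕ.∸ suc j) + (- + 1 * (+ c * (+ 0) ^ (p ℕ.∸ suc j)) + + 0)) (k>n⇒nCk≡0 l))
          refl)

    fermat : ∀ x → x ^ p ≈ x
    fermat (+ zero)      = ≡⇒≈ (0^n≡0 1≤p)
    fermat (+ suc n)     = ≈-trans (≡⇒≈ (cong (_^ p) (ℤ.+-comm (+ 1) (+ n))))
      (combine₂ (+ 1) (+ 1) (frobenius (+ n)) (fermat (+ n)) (identity ((+ n + + 1) ^ p) ((+ n) ^ p) (+ n)))
      where
      identity : ∀ x y n → x - (+ 1 + n) ≡ + 1 * (x - y - + 1 - + 0) + + 1 * (y - n)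
      identity = solve-∀
    fermat -[1+ zero ]   = combine₂ (- + 1) (+ 1) (frobenius (- + 1)) (fermat (+ 0)) (identity ((- + 1) ^ p) ((+ 0) ^ p))
      where
      identity : ∀ x y → x - - + 1 ≡ - + 1 * (y - x - + 1 - + 0) + + 1 * (y - + 0)
      identity = solve-∀
    fermat -[1+ suc n ]  = ≈-trans
      (combine₂ (- + 1) (+ 1) (frobenius -[1+ suc n ]) (fermat -[1+ n ])
        (identity (-[1+ suc n ] ^ p) (-[1+ n ] ^ p) -[1+ n ]))
      (≡⇒≈ (cong (λ k → -[1+ suc k ]) (ℕ.+-identityʳ n)))
      where
      identity : ∀ x y n → x - (n - + 1) ≡ - + 1 * (y - x - + 1 - + 0) + + 1 * (y - n)
      identity = solve-∀

    x²ᑫ≈1 : ∀ {x} → x ≉ + 0 → x ^ q * x ^ q ≈ + 1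
    x²ᑫ≈1 {x} x≉0 = cancel prime x≉0 (≈-trans (≡⇒≈ (begin
      x * (x ^ q * x ^ q) ≡⟨ cong (x *_) (sym (ℤ.^-distribˡ-+-* x q q)) ⟩
      x ^ suc (q ℕ.+ q)   ≡⟨ cong (λ k → x ^ suc (q ℕ.+ k)) (sym (ℕ.+-identityʳ q)) ⟩
      x ^ suc (2 ℕ.* q)   ≡⟨ cong (x ^_) (sym p≡1+2q) ⟩
      x ^ p               ∎)) (≈-trans (fermat x) (≡⇒≈ (sym (ℤ.*-identityʳ x)))))
      where open ≡-Reasoning

    ^-distrib-* : ∀ x y n → (x * y) ^ n ≡ x ^ n * y ^ n
    ^-distrib-* x y zero    = refl
    ^-distrib-* x y (suc n) = trans (cong (x * y *_) (^-distrib-* x y n)) (identity x y (x ^ n) (y ^ n))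
      where
      identity : ∀ x y u v → x * y * (u * v) ≡ x * u * (y * v)
      identity = solve-∀

    Nonresidue : ℤ → Set
    Nonresidue x = x ^ q ≈ - + 1

    0^q≡0 : (+ 0) ^ q ≡ + 0
    0^q≡0 = 0^n≡0 1≤q

    residue⇒≉0 : ∀ {x} → Residue x → x ≉ + 0
    residue⇒≉0 r e = 1≉0 (≈-trans (≈-sym r) (≈-trans (^-cong q e) (≡⇒≈ 0^q≡0)))

    square-residue : ∀ {x} → x ≉ + 0 → Residue (x * x)
    square-residue {x} x≉0 = ≈-trans (≡⇒≈ (^-distrib-* x x q)) (x²ᑫ≈1 x≉0)

    residue⊎nonresidue : ∀ {x} → x ≉ + 0 → Residue x ⊎ Nonresidue x
    residue⊎nonresidue {x} x≉0 = Sum.map -≈0⇒≈ -≈0⇒≈ (zero-product prime {x ^ q - + 1} {x ^ q - - + 1}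
      (combine₁ (+ 1) (x²ᑫ≈1 x≉0) (identity (x ^ q))))
      where
      identity : ∀ x → (x - + 1) * (x - - + 1) - + 0 ≡ + 1 * (x * x - + 1)
      identity = solve-∀

    residue-cong : ∀ {x y} → x ≈ y → Residue x → Residue y
    residue-cong e r = ≈-trans (^-cong q (≈-sym e)) r

    -- The case A = {0} of `bound`, where F is X^q - 1.
    roots-bound : ∀ L → Distinct L → All Residue L → length L ℕ.≤ q
    roots-bound L distinct rs = subst (ℕ._≤ q) (trans (ℕ.*-identityˡ _) (List.length-map -_ L))
      (Auxiliary.bound (+ 0 ∷ []) 0 refl (map -_ L) ([] ∷ []) (AllPairs.map⁺ (AllPairs.map negate distinct))
        (All.map⁺ (All.map (λ {x} r → residue-cong (≡⇒≈ (identity x)) r ∷ []) rs))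
        (subst (ℕ._< p) (sym (ℕ.+-identityʳ q)) q<p) 1≤q)
      where
      q<p : q ℕ.< p
      q<p = subst (q ℕ.<_) (sym p≡1+2q) (s≤s (ℕ.m≤m+n q _))
      identity : ∀ x → x ≡ - (- x) + + 0
      identity = solve-∀
      negate : ∀ {x y} → x ≉ y → - x ≉ - y
      negate {x} {y} x≉y e = x≉y (combine₁ (- + 1) e (neg x y))
        where
        neg : ∀ x y → x - y ≡ - + 1 * (- x - - y)
        neg = solve-∀

    square : ℕ → ℤ
    square i = + suc i * + suc i

    i<q⇒≉0 : ∀ {i} → i ℕ.< q → + suc i ≉ + 0
    i<q⇒≉0 {i} i<q = n<p⇒n≉0 i (subst (suc i ℕ.<_) (sym p≡1+2q) (s≤s (ℕ.≤-trans i<q (ℕ.m≤m+n q _))))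

    -- For 0 < x < y ≤ q both factors y - x and y + x of y² - x² lie strictly between 0 and p = 2 q
    -- + 1.
    squares-distinct : ∀ {i j} → i ℕ.< j → j ℕ.< q → square i ≉ square j
    squares-distinct {i} {j} i<j j<q e with ℕ.m≤n⇒∃[o]m+o≡n i<j
    ... | o , refl = *-≉0 prime (n<p⇒n≉0 o o<p) (n<p⇒n≉0 (suc i ℕ.+ suc (i ℕ.+ o)) sum<p)
      (combine₁ (- + 1) e (identity (+ i) (+ o)))
      where
      identity : ∀ i o → (+ 1 + o) * (+ 1 + (+ 1 + i + (+ 1 + (i + o)))) - + 0
        ≡ - + 1 * ((+ 1 + i) * (+ 1 + i) - (+ 1 + (+ 1 + (i + o))) * (+ 1 + (+ 1 + (i + o))))
      identity = solve-∀
      sum<p : suc (suc i ℕ.+ suc (i ℕ.+ o)) ℕ.< p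
      sum<p = subst (suc (suc i ℕ.+ suc (i ℕ.+ o)) ℕ.<_) (sym p≡1+2q) (s≤s (ℕ.≤-trans
        (ℕ.≤-reflexive (sym (ℕ.+-suc (suc i) (suc (i ℕ.+ o)))))
        (ℕ.+-mono-≤ (ℕ.≤-trans i<j (ℕ.<⇒≤ j<q)) (ℕ.≤-trans j<q (ℕ.m≤m+n q 0)))))
      o<p : suc o ℕ.< p
      o<p = ℕ.≤-<-trans (s≤s (ℕ.≤-trans (ℕ.m≤n+m o i) (ℕ.≤-trans (ℕ.n≤1+n _) (ℕ.m≤n+m (suc (i ℕ.+ o)) i)))) (ℕ.<-trans (ℕ.n<1+n _) sum<p)

    -- 1², ..., q² are already q distinct roots of X^q - 1, as many as `roots-bound` allows, so
    -- every residue is among them.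
    euler : ∀ {z} → Residue z → ∃ λ i → i ℕ.< q × square i ≈ z
    euler {z} r with Any.any? (z ≈?_) (applyUpTo square q)
    ... | yes a with Any.applyUpTo⁻ square a
    ...   | i , i<q , e = i , i<q , ≈-sym e
    euler {z} r | no ¬a = contradiction
      (roots-bound (z ∷ applyUpTo square q)
        (All.¬Any⇒All¬ _ ¬a ∷ AllPairs.applyUpTo⁺₁ square q squares-distinct)
        (r ∷ All.applyUpTo⁺₁ square q λ i<q → square-residue (i<q⇒≉0 i<q)))
      (ℕ.<⇒≱ (s≤s (ℕ.≤-reflexive (sym (List.length-applyUpTo square q)))))

    Covers : ∀ {n} → (Fin n → ℤ) → Set
    Covers f = ∀ z → Residue z → ∃ λ k → f k ≈ z

    module _ {n} (f : Fin n → ℤ) (covers : Covers f) where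

      preimage : Fin q → Fin n
      preimage i = proj₁ (covers (square (toℕ i)) (square-residue (i<q⇒≉0 (Fin.toℕ<n i))))

      preimage-square : ∀ i → f (preimage i) ≈ square (toℕ i)
      preimage-square i = proj₂ (covers (square (toℕ i)) (square-residue (i<q⇒≉0 (Fin.toℕ<n i))))

      square-injective : ∀ {i j : Fin q} → square (toℕ i) ≈ square (toℕ j) → i ≡ j
      square-injective {i} {j} e with ℕ.<-cmp (toℕ i) (toℕ j)
      ... | tri< l _ _ = contradiction e (squares-distinct l (Fin.toℕ<n j))
      ... | tri≈ _ q _ = Fin.toℕ-injective q
      ... | tri> _ _ l = contradiction (≈-sym e) (squares-distinct l (Fin.toℕ<n i))

      covers⇒q≤n : q ℕ.≤ n
      covers⇒q≤n = Fin.injective⇒≤ {f = preimage} λ {i} {j} e →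
        square-injective (≈-trans (≈-sym (preimage-square i)) (≈-trans (≡⇒≈ (cong f e)) (preimage-square j)))

      -- Preimages of the q squares can be rerouted from `k` to `k′`; then `k` itself is one more
      -- index.
      covers-twice⇒q<n : ∀ {k k′} → k ≢ k′ → f k ≈ f k′ → q ℕ.< n
      covers-twice⇒q<n {k} {k′} k≢k′ fk≈fk′ = Fin.injective⇒≤ {f = g} g-injective
        where
        avoid : ∀ l → ∃ λ l′ → l′ ≢ k × f l′ ≈ f l
        avoid l with l Fin.≟ k
        ... | yes refl = k′ , (λ e → k≢k′ (sym e)) , ≈-sym fk≈fk′
        ... | no l≢k   = l , l≢k , ≈-refl
        g : Fin (suc q) → Fin n
        g Fin.zero    = k
        g (Fin.suc i) = proj₁ (avoid (preimage i))
        g-square : ∀ i → f (g (Fin.suc i)) ≈ square (toℕ i)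
        g-square i = ≈-trans (proj₂ (proj₂ (avoid (preimage i)))) (preimage-square i)
        g-injective : ∀ {i j} → g i ≡ g j → i ≡ j
        g-injective {Fin.zero}  {Fin.zero}  e = refl
        g-injective {Fin.zero}  {Fin.suc j} e = contradiction (sym e) (proj₁ (proj₂ (avoid (preimage j))))
        g-injective {Fin.suc i} {Fin.zero}  e = contradiction e (proj₁ (proj₂ (avoid (preimage i))))
        g-injective {Fin.suc i} {Fin.suc j} e = cong Fin.suc (square-injective
          (≈-trans (≈-sym (g-square i)) (≈-trans (≡⇒≈ (cong f e)) (g-square j))))

    difference : ∀ A C → Fin (length C ℕ.* length A) → ℤ
    difference A C k = - lookup C (proj₁ (Fin.remQuot (length A) k)) + lookup A (proj₂ (Fin.remQuot {length C} (length A) k))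

    difference-combine : ∀ A C i j → difference A C (Fin.combine i j) ≡ - lookup C i + lookup A j
    difference-combine A C i j = cong (λ ij → - lookup C (proj₁ ij) + lookup A (proj₂ ij)) (Fin.remQuot-combine {length C} i j)

    product-of-sizes : ∀ A C → 1 ℕ.≤ length A → 1 ℕ.≤ length C → Distinct A → Distinct C →
      DifferencesAreResidues A C → Covers (difference A C) →
      length A ℕ.* length C ≡ q × q ℕ.+ ℕ.pred (length A) ℕ.< p
    product-of-sizes A@(_ ∷ A′) C@(c ∷ _) _ _ distinctA distinctC residues@(rs ∷ _) covers =
      ℕ.≤-antisym (Auxiliary.bound A (length A′) refl C distinctA distinctC residues E<p 1≤q)
                  (subst (q ℕ.≤_) (ℕ.*-comm (length C) (length A)) (covers⇒q≤n (difference A C) covers))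
      , E<p
      where
      -- The translate of `A` by -c consists of residues. This keeps E = q + |A| - 1 below p, as
      -- `bound` demands.
      |A|≤q : length A ℕ.≤ q
      |A|≤q = subst (ℕ._≤ q) (List.length-map (_+_ (- c)) A)
        (roots-bound (map (_+_ (- c)) A) (Distinct-translate (- c) distinctA) (All.map⁺ rs))
      E<p : q ℕ.+ length A′ ℕ.< p
      E<p = subst (q ℕ.+ length A′ ℕ.<_) (sym p≡1+2q)
        (s≤s (ℕ.+-monoʳ-≤ q (ℕ.≤-trans (ℕ.n≤1+n _) (ℕ.≤-trans |A|≤q (ℕ.m≤m+n q 0)))))

  -- Sets of two elements, and the constant `β` modulo p

  module Decompositions (p : ℕ) (prime : Prime p) (q : ℕ) (p≡1+2q : p ≡ suc (2 ℕ.* q)) (4≤q : 4 ℕ.≤ q) where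

    1≤q : 1 ℕ.≤ q
    1≤q = ℕ.≤-trans (s≤s z≤n) 4≤q

    open Residues p prime q p≡1+2q 1≤q
    open Elimination p prime using (β)

    n≤8⇒≉0 : ∀ n → suc n ℕ.≤ 8 → + suc n ≉ + 0
    n≤8⇒≉0 n l = n<p⇒n≉0 n (subst (suc n ℕ.<_) (sym p≡1+2q) (s≤s (ℕ.≤-trans l (ℕ.*-monoʳ-≤ 2 4≤q))))

    residue-* : ∀ {x y} → Residue x → Residue y → Residue (x * y)
    residue-* {x} {y} r s = ≈-trans (≡⇒≈ (^-distrib-* x y q)) (*-cong r s)

    residue-*-nonresidue : ∀ {x y} → Residue x → Nonresidue y → Nonresidue (x * y)
    residue-*-nonresidue {x} {y} r s = ≈-trans (≡⇒≈ (^-distrib-* x y q)) (*-cong r s)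

    nonresidue-* : ∀ {x y} → Nonresidue x → Nonresidue y → Residue (x * y)
    nonresidue-* {x} {y} r s = ≈-trans (≡⇒≈ (^-distrib-* x y q)) (*-cong r s)

    residue∧nonresidue⇒⊥ : ∀ {x} → Residue x → Nonresidue x → ⊥
    residue∧nonresidue⇒⊥ {x} r s = n≤8⇒≉0 1 (s≤s (s≤s z≤n)) (combine₂ (+ 1) (- + 1) s r (identity (x ^ q)))
      where
      identity : ∀ x → + 2 - + 0 ≡ + 1 * (x - - + 1) + - + 1 * (x - + 1)
      identity = solve-∀

    nonresidue⇒≉0 : ∀ {x} → Nonresidue x → x ≉ + 0
    nonresidue⇒≉0 {x} s e = 1≉0 (combine₂ (- + 1) (+ 1) (≈-trans (^-cong q e) (≡⇒≈ 0^q≡0)) s (identity (x ^ q)))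
      where
      identity : ∀ x → + 1 - + 0 ≡ - + 1 * (x - + 0) + + 1 * (x - - + 1)
      identity = solve-∀

    residue-1 : Residue (+ 1)
    residue-1 = ≡⇒≈ (ℤ.^-zeroˡ q)

    -- A set of natural numbers in which the maximal runs of consecutive elements have length 2.
    record PairedRuns (T : ℤ → Set) : Set where
      field
        neighbour : ∀ k → T (+ suc k) → T (+ suc (suc k)) ⊎ T (+ k)
        no-triple : ∀ k → T (+ k) → T (+ suc k) → T (+ suc (suc k)) → ⊥
    open PairedRuns

    neighbour-above : ∀ {T} → PairedRuns T → ∀ k → T (+ suc k) → ¬ T (+ k) → T (+ suc (suc k))
    neighbour-above runs k t ¬t = [ id , (λ t′ → contradiction t′ ¬t) ]′ (neighbour runs k t)

    runs-cong : ∀ {T U : ℤ → Set} → (∀ k → T k → U k) → (∀ k → U k → T k) → PairedRuns T → PairedRuns U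
    runs-cong to from runs = record
      { neighbour = λ k u → Sum.map (to _) (to _) (neighbour runs k (from _ u))
      ; no-triple = λ k u u′ u″ → no-triple runs k (from _ u) (from _ u′) (from _ u″)
      }

    -- Residues: 1, 2, hence not 3; then 4, 5, and 8, 9, 10.
    residues-not-paired : ¬ PairedRuns Residue
    residues-not-paired runs = no-triple runs 8 (residue-* r₂ r₄) r₉ (residue-* r₂ r₅)
      where
      r₂ : Residue (+ 2)
      r₂ = neighbour-above runs 0 residue-1 λ r → residue⇒≉0 r ≈-refl
      r₄ : Residue (+ 4)
      r₄ = residue-* r₂ r₂
      r₅ : Residue (+ 5)
      r₅ = neighbour-above runs 3 r₄ (no-triple runs 1 residue-1 r₂)
      r₉ : Residue (+ 9)
      r₉ = square-residue (n≤8⇒≉0 2 (s≤s (s≤s (s≤s z≤n))))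

    module _ (runs : PairedRuns Nonresidue) where

      -- 2 and 3 are nonresidues, 6 is not, so 5 is a residue; then 10, 11, 12 are nonresidues.
      2-not-nonresidue : ¬ Nonresidue (+ 2)
      2-not-nonresidue n₂ = [ 5-not-residue , 5-not-nonresidue ]′ (residue⊎nonresidue (n≤8⇒≉0 4 (s≤s (s≤s (s≤s (s≤s (s≤s z≤n)))))))
        where
        n₃ : Nonresidue (+ 3)
        n₃ = neighbour-above runs 1 n₂ (residue∧nonresidue⇒⊥ residue-1)
        r₄ : Residue (+ 4)
        r₄ = nonresidue-* n₂ n₂
        r₉ : Residue (+ 9)
        r₉ = nonresidue-* n₃ n₃
        5-not-nonresidue : ¬ Nonresidue (+ 5)
        5-not-nonresidue n₅ = residue∧nonresidue⇒⊥ (nonresidue-* n₂ n₃)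
          (neighbour-above runs 4 n₅ (residue∧nonresidue⇒⊥ r₄))
        5-not-residue : ¬ Residue (+ 5)
        5-not-residue r₅ = no-triple runs 10 n₁₀
          (neighbour-above runs 9 n₁₀ (residue∧nonresidue⇒⊥ r₉)) (residue-*-nonresidue r₄ n₃)
          where
          n₁₀ : Nonresidue (+ 10)
          n₁₀ = residue-*-nonresidue r₅ n₂

      -- A least nonresidue ℓ > 2 is odd, and isolated because ℓ + 1 = 2 · (ℓ + 1)/2.
      no-nonresidue-below-p : ∀ k → k ℕ.< p → ¬ Nonresidue (+ k)
      no-nonresidue-below-p = <-rec _ step
        where
        step : ∀ k → (∀ {i} → i ℕ.< k → i ℕ.< p → ¬ Nonresidue (+ i)) → k ℕ.< p → ¬ Nonresidue (+ k)
        step 0 _ _ n = nonresidue⇒≉0 n ≈-refl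
        step 1 _ _ = residue∧nonresidue⇒⊥ residue-1
        step 2 _ _ = 2-not-nonresidue
        step k@(suc (suc (suc l))) below k<p n = parity (even⊎odd k)
          where
          residue-below : ∀ i → suc i ℕ.< k → Residue (+ suc i)
          residue-below i i<k = [ id , (λ s → contradiction s (below i<k (ℕ.<-trans i<k k<p))) ]′
            (residue⊎nonresidue (n<p⇒n≉0 i (ℕ.<-trans i<k k<p)))
          r₂ : Residue (+ 2)
          r₂ = residue-below 1 (s≤s (s≤s (s≤s z≤n)))
          even⊎odd : ∀ k → (∃ λ j → k ≡ j ℕ.+ j) ⊎ (∃ λ j → k ≡ suc (j ℕ.+ j))
          even⊎odd zero = inj₁ (0 , refl)
          even⊎odd (suc k) = [ (λ { (j , e) → inj₂ (j , cong suc e) })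
                             , (λ { (j , e) → inj₁ (suc j , trans (cong suc e) (cong suc (sym (ℕ.+-suc j j)))) }) ]′ (even⊎odd k)
          double : ∀ j → suc j ℕ.< k → Residue (+ (suc j ℕ.+ suc j))
          double j j<k = residue-cong (≡⇒≈ (identity (+ suc j))) (residue-* r₂ (residue-below j j<k))
            where
            identity : ∀ x → + 2 * x ≡ x + x
            identity = solve-∀
          parity : (∃ λ j → k ≡ j ℕ.+ j) ⊎ (∃ λ j → k ≡ suc (j ℕ.+ j)) → ⊥
          parity (inj₁ (suc j , e)) = residue∧nonresidue⇒⊥
            (subst (λ i → Residue (+ i)) (sym e) (double j (subst (suc j ℕ.<_) (sym e) (ℕ.m<m+n (suc j) (s≤s z≤n))))) n
          parity (inj₂ (suc j , e)) = residue∧nonresidue⇒⊥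
            (subst (λ i → Residue (+ i)) (trans (cong (suc ∘ suc) (ℕ.+-suc j (suc j))) (sym (cong suc e))) (double (suc j) j+1<k))
            (neighbour-above runs (suc (suc l)) n (residue∧nonresidue⇒⊥
              (subst (λ i → Residue (+ i)) (sym (ℕ.suc-injective e)) (double j (ℕ.<-trans (ℕ.n<1+n _) j+1<k)))))
            where
            j+1<k : suc (suc j) ℕ.< k
            j+1<k = subst (suc (suc j) ℕ.<_) (sym e) (s≤s (s≤s (subst (suc j ℕ.≤_) (sym (ℕ.+-suc j j)) (s≤s (ℕ.m≤m+n j j)))))

    module TwoElements (a a′ : ℤ) (C : List ℤ) (a≉a′ : a ≉ a′) (distinctC : Distinct C)
                       (residues : DifferencesAreResidues (a ∷ a′ ∷ []) C)
                       (covers : Covers (difference (a ∷ a′ ∷ []) C))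
                       (size : 2 ℕ.* length C ≡ q) where

      A : List ℤ
      A = a ∷ a′ ∷ []

      d : ℤ
      d = a′ - a

      residues-at : ∀ i → Residue (- lookup C i + a) × Residue (- lookup C i + a′)
      residues-at i = pair (- lookup C i) (All.lookup residues (∈-lookup i))
        where
        pair : ∀ x → All (λ y → Residue (x + y)) A → Residue (x + a) × Residue (x + a′)
        pair x (r ∷ r′ ∷ []) = r , r′

      -- z is -c + a or -c + a′; the other difference with the same c is z + d or z - d.
      shift-neighbour : ∀ z → Residue z → Residue (z + d) ⊎ Residue (z - d)
      shift-neighbour z r = at (proj₁ ij) (proj₂ ij) (proj₂ (covers z r))
        where
        ij : Fin (length C) × Fin 2
        ij = Fin.remQuot {length C} 2 (proj₁ (covers z r))
        at : ∀ i (j : Fin 2) → - lookup C i + lookup A j ≈ z → Residue (z + d) ⊎ Residue (z - d)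
        at i Fin.zero e = inj₁ (residue-cong (combine₁ (+ 1) e (identity (lookup C i) a a′ z)) (proj₂ (residues-at i)))
          where
          identity : ∀ c a a′ z → - c + a′ - (z + (a′ - a)) ≡ + 1 * (- c + a - z)
          identity = solve-∀
        at i (Fin.suc Fin.zero) e = inj₂ (residue-cong (combine₁ (+ 1) e (identity (lookup C i) a a′ z)) (proj₁ (residues-at i)))
          where
          identity : ∀ c a a′ z → - c + a - (z - (a′ - a)) ≡ + 1 * (- c + a′ - z)
          identity = solve-∀

      -- C is maximal: one more element would violate the bound |A| |C| ≤ q.
      position : ∀ z → Residue z → Residue (z + d) → ∃ λ i → a - z ≈ lookup C i
      position z r r′ = found (Any.any? ((a - z) ≈?_) C)
        where
        identity₀ : ∀ a z → z ≡ - (a - z) + a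
        identity₀ = solve-∀
        identity₁ : ∀ a a′ z → z + (a′ - a) ≡ - (a - z) + a′
        identity₁ = solve-∀
        q+1<p : q ℕ.+ 1 ℕ.< p
        q+1<p = subst (q ℕ.+ 1 ℕ.<_) (sym p≡1+2q) (s≤s (ℕ.+-monoʳ-≤ q (ℕ.≤-trans 1≤q (ℕ.m≤m+n q 0))))
        found : Dec (Any (a - z ≈_) C) → ∃ λ i → a - z ≈ lookup C i
        found (yes e) = Any.index e , Any.lookup-index e
        found (no ¬e) = contradiction
          (Auxiliary.bound A 1 refl (a - z ∷ C) ((a≉a′ ∷ []) ∷ [] ∷ []) (All.¬Any⇒All¬ C ¬e ∷ distinctC)
            ((residue-cong (≡⇒≈ (identity₀ a z)) r ∷ residue-cong (≡⇒≈ (identity₁ a a′ z)) r′ ∷ []) ∷ residues)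
            q+1<p 1≤q)
          (ℕ.<⇒≱ (subst (ℕ._< 2 ℕ.* suc (length C)) size (ℕ.*-monoʳ-< 2 (ℕ.n<1+n (length C)))))

      -- By maximality there are c and c′ in C with z = -c + a and z + d = -c′ + a. Then z + d is
      -- also -c + a′, and a residue represented twice leaves too few pairs, since |A| |C| = q.
      no-shift-triple : ∀ z → Residue z → Residue (z + d) → Residue (z + d + d) → ⊥
      no-shift-triple z r r′ r″ = at (position z r r′) (position (z + d) r′ r″)
        where
        identity : ∀ a a′ z c c′ → - c + a′ - (- c′ + a) ≡ + 1 * (a - z - c) + - + 1 * (a - (z + (a′ - a)) - c′)
        identity = solve-∀
        at : (∃ λ i → a - z ≈ lookup C i) → (∃ λ i → a - (z + d) ≈ lookup C i) → ⊥
        at (i , e) (i′ , e′) = ℕ.<⇒≢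
          (covers-twice⇒q<n (difference A C) covers
            {Fin.combine i (Fin.suc Fin.zero)} {Fin.combine i′ Fin.zero}
            (λ k≡k′ → contradiction (proj₂ (Fin.combine-injective i _ i′ _ k≡k′)) λ ())
            (≈-trans (≡⇒≈ (difference-combine A C i _))
            (≈-trans (combine₂ (+ 1) (- + 1) e e′ (identity a a′ z (lookup C i) (lookup C i′)))
            (≡⇒≈ (sym (difference-combine A C i′ _))))))
          (trans (sym size) (ℕ.*-comm 2 (length C)))

      Class : ℤ → Set
      Class k = Residue (k * d)

      class-runs : PairedRuns Class
      class-runs = record
        { neighbour = λ k r → Sum.map (residue-cong (≡⇒≈ (up (+ k) d))) (residue-cong (≡⇒≈ (down (+ k) d)))
                                      (shift-neighbour (+ suc k * d) r)
        ; no-triple = λ k r r′ r″ → no-shift-triple (+ k * d) r (residue-cong (≡⇒≈ (next (+ k) d)) r′)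
                                      (residue-cong (≡⇒≈ (after (+ k) d)) r″)
        }
        where
        up : ∀ k d → (+ 1 + k) * d + d ≡ (+ 2 + k) * d
        up = solve-∀
        down : ∀ k d → (+ 1 + k) * d - d ≡ k * d
        down = solve-∀
        next : ∀ k d → (+ 1 + k) * d ≡ k * d + d
        next = solve-∀
        after : ∀ k d → (+ 2 + k) * d ≡ k * d + d + d
        after = solve-∀

      -- `Class` consists of the residues or of the nonresidues according to the character of d. In
      -- the second case d reduced modulo p is itself a nonresidue below p.
      impossible : ⊥
      impossible = [ residue-case , nonresidue-case ]′ (residue⊎nonresidue d≉0)
        where
        d≉0 : d ≉ + 0
        d≉0 e = a≉a′ (≈-sym (-≈0⇒≈ e))
        residue-case : ¬ Residue d
        residue-case r = residues-not-paired (runs-cong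
          (λ k s → combine₂ (- (k ^ q)) (+ 1) r (≈-trans (≡⇒≈ (sym (^-distrib-* k d q))) s) (identity (k ^ q) (d ^ q)))
          (λ k s → residue-* s r) class-runs)
          where
          identity : ∀ x y → x - + 1 ≡ - x * (y - + 1) + + 1 * (x * y - + 1)
          identity = solve-∀
        nonresidue-case : ¬ Nonresidue d
        nonresidue-case s = no-nonresidue-below-p
          (runs-cong
            (λ k r → combine₂ (k ^ q) (- + 1) s (≈-trans (≡⇒≈ (sym (^-distrib-* k d q))) r) (identity (k ^ q) (d ^ q)))
            (λ k n → nonresidue-* n s) class-runs)
          (d %ℕ p) (n%ℕd<d d p) (≈-trans (^-cong q (≈-sym d≈)) s)
          where
          instance
            p≢0 : ℕ.NonZero p
            p≢0 = ℕ.>-nonZero 1≤p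
          identity : ∀ x y → x - - + 1 ≡ x * (y - - + 1) + - + 1 * (x * y - + 1)
          identity = solve-∀
          d≈ : d ≈ + (d %ℕ p)
          d≈ = ≈-trans (≡⇒≈ (a≡a%ℕn+[a/ℕn]*n d p))
            (combine₁ (d /ℕ p) p≈0 (reduce (+ (d %ℕ p)) (d /ℕ p) (+ p)))
            where
            reduce : ∀ r t p → r + t * p - r ≡ t * (p - + 0)
            reduce = solve-∀

    -- Here `m` and `n` are |A| - 3 and |C| - 2. As p = 2 |A| |C| + 1 is at least 4 |A| + 1, the
    -- factors 3, |A| - 1 and |A| - 2 are too small to be multiples of p; only 4 |A| + 3 takes an
    -- argument.
    βm≉0 : ∀ m n → suc (suc (suc m)) ℕ.* suc (suc n) ≡ q → β (+ suc (suc (suc m))) ≉ + 0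
    βm≉0 m n mn≡q = *-≉0 prime {y = + (4 ℕ.* suc (suc (suc m)) ℕ.+ 3)} (*-≉0 prime (*-≉0 prime (n≤8⇒≉0 2 (s≤s (s≤s (s≤s z≤n))))
        (n<p⇒n≉0 (suc m) (ℕ.≤-trans (ℕ.n≤1+n _) m+3<p))) (n<p⇒n≉0 m (ℕ.≤-trans (ℕ.m≤n+m _ 2) m+3<p)))
        λ e → not-multiple (≈0⇒∣ e)
      where
      p-expansion : p ≡ 13 ℕ.+ 4 ℕ.* m ℕ.+ 2 ℕ.* ((3 ℕ.+ m) ℕ.* n)
      p-expansion = trans p≡1+2q (trans (cong (λ x → suc (2 ℕ.* x)) (sym mn≡q)) (expand m n))
        where
        expand : ∀ m n → suc (2 ℕ.* ((3 ℕ.+ m) ℕ.* (2 ℕ.+ n))) ≡ 13 ℕ.+ 4 ℕ.* m ℕ.+ 2 ℕ.* ((3 ℕ.+ m) ℕ.* n)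
        expand = ℕ-Solver.solve-∀
      13+4m≤p : 13 ℕ.+ 4 ℕ.* m ℕ.≤ p
      13+4m≤p = subst (13 ℕ.+ 4 ℕ.* m ℕ.≤_) (sym p-expansion) (ℕ.m≤m+n _ _)
      m+3<p : suc (suc (suc m)) ℕ.< p
      m+3<p = ℕ.≤-trans (ℕ.+-mono-≤ {4} {13} (s≤s (s≤s (s≤s (s≤s z≤n)))) (ℕ.m≤m+n m (3 ℕ.* m))) 13+4m≤p
      4M+3 : 4 ℕ.* suc (suc (suc m)) ℕ.+ 3 ≡ 15 ℕ.+ 4 ℕ.* m
      4M+3 = expand m
        where
        expand : ∀ m → 4 ℕ.* (3 ℕ.+ m) ℕ.+ 3 ≡ 15 ℕ.+ 4 ℕ.* m
        expand = ℕ-Solver.solve-∀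
      -- With M = m + 3, p = 2 M (n + 2) + 1 is 4 M + 1 for n = 0 and exceeds 4 M + 3 for n > 0.
      not-multiple : ¬ p ℕ.∣ 4 ℕ.* suc (suc (suc m)) ℕ.+ 3
      not-multiple (ℕ.divides zero e) = ℕ.1+n≢0 (trans (sym 4M+3) e)
      not-multiple (ℕ.divides (suc zero) e) = odd-gap n (ℕ.+-cancelˡ-≡ (13 ℕ.+ 4 ℕ.* m) _ _
        (trans (shuffle m) (trans (sym 4M+3) (trans e (trans (ℕ.+-identityʳ p) p-expansion)))))
        where
        shuffle : ∀ m → 13 ℕ.+ 4 ℕ.* m ℕ.+ 2 ≡ 15 ℕ.+ 4 ℕ.* m
        shuffle = ℕ-Solver.solve-∀
        odd-gap : ∀ n → 2 ≢ 2 ℕ.* ((3 ℕ.+ m) ℕ.* n)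
        odd-gap zero e with trans e (cong (2 ℕ.*_) (ℕ.*-zeroʳ (3 ℕ.+ m)))
        ... | ()
        odd-gap (suc n) e = ℕ.<⇒≢ (ℕ.≤-trans (s≤s (s≤s (s≤s z≤n))) (ℕ.*-monoʳ-≤ 2 (ℕ.m≤m*n (3 ℕ.+ m) (suc n)))) e
      not-multiple (ℕ.divides (suc (suc t)) e) = ℕ.<⇒≢
        (ℕ.<-≤-trans
          (subst (ℕ._< 13 ℕ.+ 4 ℕ.* m ℕ.+ (13 ℕ.+ 4 ℕ.* m)) (sym 4M+3)
            (ℕ.≤-trans (s≤s (ℕ.m≤m+n (15 ℕ.+ 4 ℕ.* m) (10 ℕ.+ 4 ℕ.* m))) (ℕ.≤-reflexive (shuffle m))))
          (ℕ.≤-trans (ℕ.+-mono-≤ 13+4m≤p 13+4m≤p) (ℕ.+-monoʳ-≤ p (ℕ.m≤m+n p (t ℕ.* p)))))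
        e
        where
        shuffle : ∀ m → suc (15 ℕ.+ 4 ℕ.* m ℕ.+ (10 ℕ.+ 4 ℕ.* m)) ≡ 13 ℕ.+ 4 ℕ.* m ℕ.+ (13 ℕ.+ 4 ℕ.* m)
        shuffle = ℕ-Solver.solve-∀

  -- The relations between the sizes of A and C

  module Differences (p : ℕ) (prime : Prime p) (q : ℕ) (p≡1+2q : p ≡ suc (2 ℕ.* q)) (1≤q : 1 ℕ.≤ q) where

    open Residues p prime q p≡1+2q 1≤q

    ratio-of-sizes : ∀ A C → 2 ℕ.≤ length A → 2 ℕ.≤ length C → Distinct A → Distinct C →
      DifferencesAreResidues A C → Covers (difference A C) →
      length A ℕ.* length C ≡ q × 2 ℕ.+ length C ℕ.≤ 2 ℕ.* length A
    ratio-of-sizes A C 2≤|A| 2≤|C| distinctA distinctC residues covers = mn≡q , bounded A C refl refl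
      where
      sizes : length A ℕ.* length C ≡ q × q ℕ.+ ℕ.pred (length A) ℕ.< p
      sizes = product-of-sizes A C (ℕ.<⇒≤ 2≤|A|) (ℕ.<⇒≤ 2≤|C|) distinctA distinctC residues covers
      mn≡q : length A ℕ.* length C ≡ q
      mn≡q = proj₁ sizes
      4≤q : 4 ℕ.≤ q
      4≤q = subst (4 ℕ.≤_) mn≡q (ℕ.*-mono-≤ 2≤|A| 2≤|C|)
      open Decompositions p prime q p≡1+2q 4≤q using (module TwoElements; βm≉0)
      open Sharpening p prime q using (module Local)
      bounded : ∀ A′ C′ → A′ ≡ A → C′ ≡ C → 2 ℕ.+ length C ℕ.≤ 2 ℕ.* length A
      bounded []      _       refl refl = contradiction 2≤|A| λ ()
      bounded (_ ∷ []) _      refl refl = contradiction 2≤|A| λ { (s≤s ()) }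
      bounded _       []      refl refl = contradiction 2≤|C| λ ()
      bounded _ (_ ∷ [])      refl refl = contradiction 2≤|C| λ { (s≤s ()) }
      -- `β` is zero for |A| = 2, so this case is excluded by the argument on runs.
      bounded (a ∷ a′ ∷ []) C′@(_ ∷ _ ∷ _) refl refl = two-elements distinctA
        where
        two-elements : Distinct (a ∷ a′ ∷ []) → _
        two-elements ((a≉a′ ∷ []) ∷ _) =
          ⊥-elim (TwoElements.impossible a a′ C′ a≉a′ distinctC residues covers mn≡q)
      bounded (_ ∷ _ ∷ _ ∷ A″) (_ ∷ _ ∷ C″) refl refl = subst (2 ℕ.+ length C ℕ.≤_) (shuffle (length A″)) (s≤s (s≤s
        (Local.sharp A m refl C distinctA distinctC residues mn≡q (proj₂ sizes) p≡1+2q (s≤s z≤n)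
          (q ℕ.∸ 3) (sym (ℕ.m+[n∸m]≡n (ℕ.<⇒≤ 4≤q))) (+ suc m) refl (βm≉0 (length A″) (length C″) mn≡q) refl)))
        where
        m : ℕ
        m = suc (suc (length A″))
        shuffle : ∀ l → 2 ℕ.+ (2 ℕ.+ l ℕ.+ (2 ℕ.+ l)) ≡ 2 ℕ.* (3 ℕ.+ l)
        shuffle = ℕ-Solver.solve-∀

  -- From subsets of `Fin p` to lists of integers

  elements : ∀ {n} → Subset n → List (Fin n)
  elements []          = []
  elements (true ∷ A)  = Fin.zero ∷ map Fin.suc (elements A)
  elements (false ∷ A) = map Fin.suc (elements A)

  length-elements : ∀ {n} (A : Subset n) → length (elements A) ≡ ∣ A ∣
  length-elements []          = refl
  length-elements (true ∷ A)  = cong suc (trans (List.length-map Fin.suc (elements A)) (length-elements A))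
  length-elements (false ∷ A) = trans (List.length-map Fin.suc (elements A)) (length-elements A)

  ∈-elements : ∀ {n} {A : Subset n} {x} → x ∈ˢ A → x ∈ elements A
  ∈-elements here                       = here refl
  ∈-elements {A = true ∷ A}  (there x∈) = there (∈-map⁺ Fin.suc (∈-elements x∈))
  ∈-elements {A = false ∷ A} (there x∈) = ∈-map⁺ Fin.suc (∈-elements x∈)

  elements-∈ : ∀ {n} (A : Subset n) → All (_∈ˢ A) (elements A)
  elements-∈ []          = []
  elements-∈ (true ∷ A)  = here ∷ All.map⁺ (All.map there (elements-∈ A))
  elements-∈ (false ∷ A) = All.map⁺ (All.map there (elements-∈ A))

  elements-unique : ∀ {n} (A : Subset n) → AllPairs _≢_ (elements A)
  elements-unique []          = []
  elements-unique (true ∷ A)  = All.map⁺ (All.universal (λ _ ()) _)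
                              ∷ AllPairs.map⁺ (AllPairs.map (λ x≢y e → x≢y (Fin.suc-injective e)) (elements-unique A))
  elements-unique (false ∷ A) = AllPairs.map⁺ (AllPairs.map (λ x≢y e → x≢y (Fin.suc-injective e)) (elements-unique A))

  module Sumsets (p : ℕ) .{{_ : NonZero p}} (prime : Prime p) (q : ℕ) (p≡1+2q : p ≡ suc (2 ℕ.* q)) (1≤q : 1 ℕ.≤ q) where

    open Residues p prime q p≡1+2q 1≤q
    open Differences p prime q p≡1+2q 1≤q

    value : Fin p → ℤ
    value x = + toℕ x

    value-mod : ∀ n → value (n mod p) ≈ + n
    value-mod n = ≈-trans (≡⇒≈ (cong +_ (Fin.toℕ-fromℕ< _)))
      (≈-sym (≈-trans (≡⇒≈ (trans (cong +_ (m≡m%n+[m/n]*n n p)) (cong (_+_ (+ (n % p))) (ℤ.pos-* (n / p) p))))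
        (combine₁ (+ (n / p)) p≈0 (identity (+ (n % p)) (+ (n / p)) (+ p)))))
      where
      identity : ∀ r t p → r + t * p - r ≡ t * (p - + 0)
      identity = solve-∀

    <⇒≉ : ∀ {x y} → x ℕ.< y → y ℕ.< p → + x ≉ + y
    <⇒≉ {x} {y} x<y y<p e = at (ℕ.m≤n⇒∃[o]m+o≡n x<y)
      where
      identity : ∀ x o → + 1 + o - + 0 ≡ - + 1 * (x - (+ 1 + (x + o)))
      identity = solve-∀
      at : (∃ λ o → suc x ℕ.+ o ≡ y) → ⊥
      at (o , refl) = n<p⇒n≉0 o (ℕ.≤-<-trans (s≤s (ℕ.m≤n+m o x)) y<p) (combine₁ (- + 1) e (identity (+ x) (+ o)))

    value-injective : ∀ {x y} → value x ≈ value y → x ≡ y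
    value-injective {x} {y} e = at (ℕ.<-cmp (toℕ x) (toℕ y))
      where
      at : _ → x ≡ y
      at (tri< l _ _) = contradiction e (<⇒≉ l (Fin.toℕ<n y))
      at (tri≈ _ x≡y _) = Fin.toℕ-injective x≡y
      at (tri> _ _ l) = contradiction (≈-sym e) (<⇒≉ l (Fin.toℕ<n x))

    value-+ₚ : ∀ x y → value (x +ₚ y) ≈ value x + value y
    value-+ₚ x y = value-mod (toℕ x ℕ.+ toℕ y)

    value-*ₚ : ∀ x y → value (x *ₚ y) ≈ value x * value y
    value-*ₚ x y = ≈-trans (value-mod (toℕ x ℕ.* toℕ y)) (≡⇒≈ (ℤ.pos-* (toℕ x) (toℕ y)))

    isQR⇒residue : ∀ {z} → IsQR z → Residue (value z)
    isQR⇒residue (x , x≢0 , refl) = residue-cong (≈-sym (value-*ₚ x x)) (square-residue (nonzero x x≢0))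
      where
      nonzero : ∀ (x : Fin p) → toℕ x ≢ 0 → value x ≉ + 0
      nonzero x x≢0 e = <⇒≉ (ℕ.n≢0⇒n>0 x≢0) (Fin.toℕ<n x) (≈-sym e)

    -- Euler's criterion supplies a square root among 1, ..., q, hence an element of `Fin p`; z is
    -- an arbitrary integer, so it is matched only up to congruence.
    residue⇒isQR : ∀ {z} → Residue z → ∃ λ w → IsQR w × value w ≈ z
    residue⇒isQR r = at (euler r)
      where
      at : ∀ {z} → (∃ λ i → i ℕ.< q × square i ≈ z) → ∃ λ w → IsQR w × value w ≈ z
      at (i , i<q , e) = x *ₚ x , (x , (λ x≡0 → ℕ.1+n≢0 (trans (sym toℕ-x) x≡0)) , refl)
                       , ≈-trans (value-*ₚ x x) (≈-trans (≡⇒≈ (cong (λ k → + k * + k) toℕ-x)) e)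
        where
        1+i<p : suc i ℕ.< p
        1+i<p = subst (suc i ℕ.<_) (sym p≡1+2q) (s≤s (ℕ.≤-trans i<q (ℕ.m≤m+n q _)))
        x : Fin p
        x = Fin.fromℕ< 1+i<p
        toℕ-x : toℕ x ≡ suc i
        toℕ-x = Fin.toℕ-fromℕ< 1+i<p

    module _ (A B : Subset p) (sumset : SumsetIsQR A B) where

      values negatives : List ℤ
      values    = map value (elements A)
      negatives = map (-_ ∘ value) (elements B)

      values-distinct : Distinct values
      values-distinct = AllPairs.map⁺ (AllPairs.map (λ x≢y e → x≢y (value-injective e)) (elements-unique A))

      negatives-distinct : Distinct negatives
      negatives-distinct = AllPairs.map⁺ (AllPairs.map
        (λ {x} {y} x≢y e → x≢y (value-injective (combine₁ (- + 1) e (identity (value x) (value y))))) (elements-unique B))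
        where
        identity : ∀ x y → x - y ≡ - + 1 * (- x - - y)
        identity = solve-∀

      sums-are-residues : DifferencesAreResidues values negatives
      sums-are-residues = All.map⁺ (All.map (λ {b} b∈B → All.map⁺ (All.map (λ {a} a∈A →
        residue-cong (≈-trans (value-+ₚ a b) (≡⇒≈ (identity (value a) (value b))))
          (isQR⇒residue (Equivalence.to (sumset (a +ₚ b)) (a , b , a∈A , b∈B , refl))))
        (elements-∈ A))) (elements-∈ B))
        where
        identity : ∀ a b → a + b ≡ - (- b) + a
        identity = solve-∀

      sums-cover : Covers (difference values negatives)
      sums-cover z r = at (residue⇒isQR r)
        where
        identity : ∀ a b → - (- b) + a ≡ a + b
        identity = solve-∀
        represented : ∀ {w} → InSumset A B w → value w ≈ z → ∃ λ k → difference values negatives k ≈ z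
        represented (a , b , a∈A , b∈B , refl) e = Fin.combine (Any.index b∈) (Any.index a∈) , ≈-trans (≡⇒≈ (begin
          difference values negatives (Fin.combine (Any.index b∈) (Any.index a∈))
            ≡⟨ difference-combine values negatives (Any.index b∈) (Any.index a∈) ⟩
          - lookup negatives (Any.index b∈) + lookup values (Any.index a∈)
            ≡⟨ cong₂ (λ x y → - x + y) (sym (Any.lookup-index b∈)) (sym (Any.lookup-index a∈)) ⟩
          - (- value b) + value a
            ≡⟨ identity (value a) (value b) ⟩
          value a + value b ∎)) (≈-trans (≈-sym (value-+ₚ a b)) e)
          where
          open ≡-Reasoning
          a∈ : value a ∈ values
          a∈ = ∈-map⁺ value (∈-elements a∈A)
          b∈ : - value b ∈ negatives
          b∈ = ∈-map⁺ (-_ ∘ value) (∈-elements b∈B)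
        at : (∃ λ w → IsQR w × value w ≈ z) → _
        at (w , qr , e) = represented (Equivalence.from (sumset w) qr) e

      sumset-sizes : 2 ℕ.≤ ∣ A ∣ → 2 ℕ.≤ ∣ B ∣ → ∣ A ∣ ℕ.* ∣ B ∣ ≡ q × 2 ℕ.+ ∣ B ∣ ℕ.≤ 2 ℕ.* ∣ A ∣
      sumset-sizes 2≤|A| 2≤|B| =
        subst₂ (λ m n → m ℕ.* n ≡ q × 2 ℕ.+ n ℕ.≤ 2 ℕ.* m) |values| |negatives|
          (ratio-of-sizes values negatives (subst (2 ℕ.≤_) (sym |values|) 2≤|A|) (subst (2 ℕ.≤_) (sym |negatives|) 2≤|B|)
            values-distinct negatives-distinct sums-are-residues sums-cover)
        where
        |values| : length values ≡ ∣ A ∣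
        |values| = trans (List.length-map value (elements A)) (length-elements A)
        |negatives| : length negatives ≡ ∣ B ∣
        |negatives| = trans (List.length-map (-_ ∘ value) (elements B)) (length-elements B)

  sumset-comm : ∀ {p} .{{_ : NonZero p}} {A B : Subset p} → SumsetIsQR A B → SumsetIsQR B A
  sumset-comm sumset z = mk⇔
    (λ { (b , a , b∈B , a∈A , e) → Equivalence.to (sumset z)
           (a , b , a∈A , b∈B , trans (cong (_mod _) (ℕ.+-comm (toℕ a) (toℕ b))) e) })
    (λ qr → swap (Equivalence.from (sumset z) qr))
    where
    swap : InSumset _ _ z → InSumset _ _ z
    swap (a , b , a∈A , b∈B , e) = b , a , b∈B , a∈A , trans (cong (_mod _) (ℕ.+-comm (toℕ b) (toℕ a))) e

-- The numerical bounds

open SumsetsOfSquares using (module Sumsets; sumset-comm)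
open import Data.Nat using (ℕ; suc; s≤s; z≤n; _+_; _*_; _∸_; _≤_; _<_; NonZero)

-- Already (n + 1)² = (n + 2) n + 1 ≤ 2 m n + 1 = p; the 4 comes from squaring n + 1 < 2 √p.
upper-bound : ∀ m n → 2 + n ≤ 2 * m → (n + 1) * (n + 1) < 4 * suc (2 * (m * n))
upper-bound m n 2+n≤2m = begin-strict
  (n + 1) * (n + 1)        ≡⟨ expand n ⟩
  suc ((2 + n) * n)        ≤⟨ s≤s (ℕ.*-monoˡ-≤ n 2+n≤2m) ⟩
  suc (2 * m * n)          ≡⟨ cong suc (ℕ.*-assoc 2 m n) ⟩
  suc (2 * (m * n))        <⟨ ℕ.m<m+n _ (s≤s z≤n) ⟩
  4 * suc (2 * (m * n))    ∎
  where
  open ℕ.≤-Reasoning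
  expand : ∀ n → (n + 1) * (n + 1) ≡ suc ((2 + n) * n)
  expand = ℕ-Solver.solve-∀

-- From n ≤ 2 m - 2 follows p = 2 m n + 1 ≤ (2 m - 1)², so 2 √p ≤ 4 m - 2 ≤ 8 m - 1. The outer
-- inequality is √p / 4 + 1 / 8 ≤ m, multiplied by 8 and squared.
lower-bound : ∀ m n → 2 + n ≤ 2 * m → 4 * suc (2 * (m * n)) ≤ (8 * m ∸ 1) * (8 * m ∸ 1)
lower-bound (suc m) n 2+n≤2m = begin
  4 * suc (2 * (suc m * n))
    ≤⟨ ℕ.*-monoʳ-≤ 4 (s≤s (ℕ.*-monoʳ-≤ 2 (ℕ.*-monoʳ-≤ (suc m) n≤2m))) ⟩
  4 * suc (2 * (suc m * (2 * m)))
    ≤⟨ ℕ.m≤m+n _ _ ⟩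
  -- With `suc m` for m the two sides are 4 (2 m + 1)² and (8 m + 7)²; the added polynomial is their
  -- difference.
  4 * suc (2 * (suc m * (2 * m))) + (45 + 96 * m + 48 * (m * m))
    ≡⟨ expand m ⟩
  (m + 7 * suc m) * (m + 7 * suc m) ∎
  where
  open ℕ.≤-Reasoning
  n≤2m : n ≤ 2 * m
  n≤2m = ℕ.s≤s⁻¹ (ℕ.s≤s⁻¹ (subst (2 + n ≤_) (ℕ.*-suc 2 m) 2+n≤2m))
  expand : ∀ m → 4 * (1 + 2 * ((1 + m) * (2 * m))) + (45 + 96 * m + 48 * (m * m))
               ≡ (m + 7 * (1 + m)) * (m + 7 * (1 + m))
  expand = ℕ-Solver.solve-∀

theorem1p1 : (p : ℕ) .{{_ : NonZero p}} → Prime p → p % 2 ≡ 1 →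
    (A B : Subset p) → 2 ≤ ∣ A ∣ → 2 ≤ ∣ B ∣ → SumsetIsQR A B →
    ((4 * p ≤ (8 * ∣ A ∣ ∸ 1) * (8 * ∣ A ∣ ∸ 1)) × ((∣ A ∣ + 1) * (∣ A ∣ + 1) < 4 * p))
    × ((4 * p ≤ (8 * ∣ B ∣ ∸ 1) * (8 * ∣ B ∣ ∸ 1)) × ((∣ B ∣ + 1) * (∣ B ∣ + 1) < 4 * p))
theorem1p1 p isPrime odd A B 2≤|A| 2≤|B| sumset =
  ( subst (λ k → 4 * k ≤ (8 * ∣ A ∣ ∸ 1) * (8 * ∣ A ∣ ∸ 1)) (sym p≡AB)
      (lower-bound ∣ A ∣ ∣ B ∣ (proj₂ sizes))
  , subst (λ k → (∣ A ∣ + 1) * (∣ A ∣ + 1) < 4 * k) (sym p≡BA)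
      (upper-bound ∣ B ∣ ∣ A ∣ (proj₂ sizes′)))
  , ( subst (λ k → 4 * k ≤ (8 * ∣ B ∣ ∸ 1) * (8 * ∣ B ∣ ∸ 1)) (sym p≡BA)
      (lower-bound ∣ B ∣ ∣ A ∣ (proj₂ sizes′))
  , subst (λ k → (∣ B ∣ + 1) * (∣ B ∣ + 1) < 4 * k) (sym p≡AB)
      (upper-bound ∣ A ∣ ∣ B ∣ (proj₂ sizes)))
  where
  q : ℕ
  q = p / 2
  p≡1+2q : p ≡ suc (2 * q)
  p≡1+2q = trans (m≡m%n+[m/n]*n p 2) (cong₂ _+_ odd (ℕ.*-comm q 2))
  1≤q : 1 ≤ q
  1≤q = ℕ.n≢0⇒n>0 λ q≡0 → ℕ.<⇒≢ (ℕ.nonTrivial⇒n>1 p {{prime⇒nonTrivial isPrime}})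
    (sym (trans p≡1+2q (cong (λ k → suc (2 * k)) q≡0)))
  open Sumsets p isPrime q p≡1+2q 1≤q
  sizes : ∣ A ∣ * ∣ B ∣ ≡ q × 2 + ∣ B ∣ ≤ 2 * ∣ A ∣
  sizes = sumset-sizes A B sumset 2≤|A| 2≤|B|
  -- The roles of A and B are exchanged: `sizes` bounds |A| from below and |B| from above, `sizes′`
  -- the other way round.
  sizes′ : ∣ B ∣ * ∣ A ∣ ≡ q × 2 + ∣ A ∣ ≤ 2 * ∣ B ∣
  sizes′ = sumset-sizes B A (sumset-comm {A = A} {B} sumset) 2≤|B| 2≤|A|
  p≡AB : p ≡ suc (2 * (∣ A ∣ * ∣ B ∣))
  p≡AB = trans p≡1+2q (cong (λ k → suc (2 * k)) (sym (proj₁ sizes)))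
  p≡BA : p ≡ suc (2 * (∣ B ∣ * ∣ A ∣))
  p≡BA = trans p≡1+2q (cong (λ k → suc (2 * k)) (sym (proj₁ sizes′)))
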